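{- Let $K$ be a field, $n\ge1$ an integer, and $E$ a finite directed graph such that $L_K(E)\cong M_n(K)$ as $K$-algebras. Then the number of edges of $E$ is at least $$N_n:=\max\{N\in\mathbb{N}\mid n\ge SP^N_*\}.$$
   Context: A directed graph $E=(E^0,E^1,s,t)$ has vertices $E^0$, edges $E^1$ and source and target maps $s,t\colon E^1\to E^0$ (multiple edges allowed). A finite path of length $m\ge1$ is a tuple $(e_1,\dots,e_m)$ of edges with $t(e_i)=s(e_{i+1})$, ending at $t(e_m)$; vertices are paths of length $0$. A sink is a vertex emitting no edges. Acyclic means there is no path of positive length with equal beginning and end; connected means any two vertices are joined by an undirected path. For $N\in\mathbb{N}$, $SP^N_*$ denotes the maximal number of finite paths ending in the sink, over all connected acyclic directed graphs with exactly $N$ edges and exactly one sink (so $SP^0_*=1$, from a single vertex). For a finite directed graph $E$ and a field $K$, the Leavitt path algebra $L_K(E)$ is the universal associative $K$-algebra generated by $\{v: v\in E^0\}\cup\{e,e^*: e\in E^1\}$ with relations: $vw=\delta_{v,w}v$ for $v,w\in E^0$; $s(e)e=e=e\,t(e)$ and $t(e)e^*=e^*=e^*s(e)$ for $e\in E^1$; $e^*f=\delta_{e,f}t(e)$ for $e,f\in E^1$; and $v=\sum_{e\in s^{ -1}(v)}ee^*$ for every vertex $v$ that is not a sink. -}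

module Defs where

open import Level using (Level; _⊔_; suc)
open import Algebra.Bundles using (CommutativeRing; AbelianGroup)
open import Algebra.Module.Bundles using (LeftModule)
open import Algebra.Module.Morphism.Structures using (IsLeftModuleIsomorphism)
import Algebra.Construct.Pointwise as Pointwise
import Algebra.Properties.Semiring.Sum as SemiringSum
open import Data.Fin.Base using (Fin)
open import Data.Fin.Properties using (_≟_)
open import Data.List.Base using (List; foldr; map; filter; allFin)
open import Data.Nat.Base using (ℕ; _≤_)
open import Data.Product.Base using (_×_; _,_; Σ-syntax; ∃; ∃-syntax)
open import Function.Bundles using (_↔_)
open import Relation.Binary.Construct.Closure.Equivalence using (EqClosure)
open import Relation.Binary.Construct.Closure.ReflexiveTransitive using (Star)
open import Relation.Binary.Construct.Closure.Transitive using (TransClosure)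
open import Relation.Binary.Core using (Rel)
open import Relation.Binary.PropositionalEquality.Core using (_≡_; _≢_)
open import Relation.Nullary.Negation using (¬_)

private
  variable
    a b c ℓ ℓa ℓb r x : Level

------------------------------------------------------------------------
-- Fields and associative algebras

record Field c ℓ : Set (suc (c ⊔ ℓ)) where
  field
    commutativeRing : CommutativeRing c ℓ
  open CommutativeRing commutativeRing public
  field
    1≉0     : ¬ (1# ≈ 0#)
    inverse : ∀ k → ¬ (k ≈ 0#) → ∃[ k⁻¹ ] (k * k⁻¹ ≈ 1#)

-- No unit element is required: the Leavitt path algebra is presented by
-- generators and relations among associative, not necessarily unital,
-- algebras.  For a finite graph it has a unit, the sum of all vertices.
record Algebra (K : Field c ℓ) a ℓa : Set (c ⊔ ℓ ⊔ suc (a ⊔ ℓa)) where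
  open Field K using (ring)
  field
    leftModule : LeftModule ring a ℓa
  open LeftModule leftModule public
  infixl 7 _∙_
  field
    _∙_       : Carrierᴹ → Carrierᴹ → Carrierᴹ
    ∙-cong    : ∀ {x x′ y y′} → x ≈ᴹ x′ → y ≈ᴹ y′ → (x ∙ y) ≈ᴹ (x′ ∙ y′)
    ∙-assoc   : ∀ x y z → ((x ∙ y) ∙ z) ≈ᴹ (x ∙ (y ∙ z))
    ∙-distribˡ : ∀ x y z → (x ∙ (y +ᴹ z)) ≈ᴹ ((x ∙ y) +ᴹ (x ∙ z))
    ∙-distribʳ : ∀ x y z → ((y +ᴹ z) ∙ x) ≈ᴹ ((y ∙ x) +ᴹ (z ∙ x))
    *ₗ-∙ˡ     : ∀ k x y → ((k *ₗ x) ∙ y) ≈ᴹ (k *ₗ (x ∙ y))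
    *ₗ-∙ʳ     : ∀ k x y → (x ∙ (k *ₗ y)) ≈ᴹ (k *ₗ (x ∙ y))

-- A bijective linear multiplicative map automatically matches units
-- whenever one side has a unit.
record _≅_ {K : Field c ℓ} (A : Algebra K a ℓa) (B : Algebra K b ℓb)
           : Set (c ⊔ ℓ ⊔ a ⊔ ℓa ⊔ b ⊔ ℓb) where
  private
    module A = Algebra A
    module B = Algebra B
  field
    to : A.Carrierᴹ → B.Carrierᴹ
    isLeftModuleIsomorphism :
      IsLeftModuleIsomorphism A.rawLeftModule B.rawLeftModule to
    ∙-homo : ∀ x y → to (x A.∙ y) B.≈ᴹ (to x B.∙ to y)

------------------------------------------------------------------------
-- The matrix algebra

module _ (K : Field c ℓ) (n : ℕ) where
  open Field K
  open SemiringSum semiring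

  Matrix : Set c
  Matrix = Fin n → Fin n → Carrier

  private
    additiveGroup : AbelianGroup c ℓ
    additiveGroup =
      Pointwise.abelianGroup (Fin n) (Pointwise.abelianGroup (Fin n) +-abelianGroup)
    module M = AbelianGroup additiveGroup

    _⊗_ : Matrix → Matrix → Matrix
    (A ⊗ B) i j = ∑[ k < n ] (A i k * B k j)

    ⊗-assoc : ∀ A B C i j → ((A ⊗ B) ⊗ C) i j ≈ (A ⊗ (B ⊗ C)) i j
    ⊗-assoc A B C i j =
      trans (sum-cong-≋ λ l → *-distribʳ-sum (C l j) (λ k → A i k * B k l))
      (trans (∑-comm λ l k → (A i k * B k l) * C l j)
      (sum-cong-≋ λ k →
        trans (sum-cong-≋ λ l → *-assoc (A i k) (B k l) (C l j))
              (sym (*-distribˡ-sum (A i k) (λ l → B k l * C l j)))))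

  matrixAlgebra : Algebra K c ℓ
  matrixAlgebra = record
    { leftModule = record
      { Carrierᴹ = Matrix
      ; _≈ᴹ_ = M._≈_
      ; _+ᴹ_ = M._∙_
      ; _*ₗ_ = λ k A i j → k * A i j
      ; 0ᴹ = M.ε
      ; -ᴹ_ = M._⁻¹
      ; isLeftModule = record
        { isLeftSemimodule = record
          { +ᴹ-isCommutativeMonoid = M.isCommutativeMonoid
          ; isPreleftSemimodule = record
            { *ₗ-cong = λ k≈l A≈B i j → *-cong k≈l (A≈B i j)
            ; *ₗ-zeroˡ = λ A i j → zeroˡ (A i j)
            ; *ₗ-distribʳ = λ A k l i j → distribʳ (A i j) k l
            ; *ₗ-identityˡ = λ A i j → *-identityˡ (A i j)
            ; *ₗ-assoc = λ k l A i j → *-assoc k l (A i j)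
            ; *ₗ-zeroʳ = λ k i j → zeroʳ k
            ; *ₗ-distribˡ = λ k A B i j → distribˡ k (A i j) (B i j)
            }
          }
        ; -ᴹ‿cong = M.⁻¹-cong
        ; -ᴹ‿inverse = M.inverse
        }
      }
    ; _∙_ = _⊗_
    ; ∙-cong = λ A≈A′ B≈B′ i j → sum-cong-≋ λ k → *-cong (A≈A′ i k) (B≈B′ k j)
    ; ∙-assoc = ⊗-assoc
    ; ∙-distribˡ = λ A B C i j →
        trans (sum-cong-≋ λ k → distribˡ (A i k) (B k j) (C k j))
              (∑-distrib-+ (λ k → A i k * B k j) (λ k → A i k * C k j))
    ; ∙-distribʳ = λ A B C i j →
        trans (sum-cong-≋ λ k → distribʳ (A k j) (B i k) (C i k))
              (∑-distrib-+ (λ k → B i k * A k j) (λ k → C i k * A k j))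
    ; *ₗ-∙ˡ = λ k A B i j →
        trans (sum-cong-≋ λ l → *-assoc k (A i l) (B l j))
              (sym (*-distribˡ-sum k (λ l → A i l * B l j)))
    ; *ₗ-∙ʳ = λ k A B i j →
        trans (sum-cong-≋ λ l →
                 trans (sym (*-assoc (A i l) k (B l j)))
                 (trans (*-cong (*-comm (A i l) k) refl)
                        (*-assoc k (A i l) (B l j))))
              (sym (*-distribˡ-sum k (λ l → A i l * B l j)))
    }

------------------------------------------------------------------------
-- Algebras given by generators and relations

infixl 6 _⊕_
infixl 7 _⊙_
infixr 8 _·_
infixr 8 ⊖_

data Term (K : Field c ℓ) (X : Set x) : Set (c ⊔ x) where
  gen : X → Term K X
  𝟘   : Term K X
  _⊕_ : Term K X → Term K X → Term K X
  ⊖_  : Term K X → Term K X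
  _·_ : Field.Carrier K → Term K X → Term K X
  _⊙_ : Term K X → Term K X → Term K X

-- The least congruence that contains R and satisfies the axioms of an
-- associative K-algebra; terms modulo it are the universal such algebra
-- on X subject to R.
module _ (K : Field c ℓ) {X : Set x} (R : Rel (Term K X) r) where
  open Field K

  data Congruence : Rel (Term K X) (c ⊔ ℓ ⊔ x ⊔ r) where
    relation : ∀ {s t} → R s t → Congruence s t

    ≈-refl  : ∀ {s} → Congruence s s
    ≈-sym   : ∀ {s t} → Congruence s t → Congruence t s
    ≈-trans : ∀ {s t u} → Congruence s t → Congruence t u → Congruence s u

    ⊕-cong : ∀ {s s′ t t′} → Congruence s s′ → Congruence t t′ →
             Congruence (s ⊕ t) (s′ ⊕ t′)
    ⊖-cong : ∀ {s s′} → Congruence s s′ → Congruence (⊖ s) (⊖ s′)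
    ·-cong : ∀ {k k′ s s′} → k ≈ k′ → Congruence s s′ →
             Congruence (k · s) (k′ · s′)
    ⊙-cong : ∀ {s s′ t t′} → Congruence s s′ → Congruence t t′ →
             Congruence (s ⊙ t) (s′ ⊙ t′)

    ⊕-assoc     : ∀ s t u → Congruence ((s ⊕ t) ⊕ u) (s ⊕ (t ⊕ u))
    ⊕-comm      : ∀ s t → Congruence (s ⊕ t) (t ⊕ s)
    ⊕-identityˡ : ∀ s → Congruence (𝟘 ⊕ s) s
    ⊖-inverseˡ  : ∀ s → Congruence (⊖ s ⊕ s) 𝟘

    ·-identity  : ∀ s → Congruence (1# · s) s
    ·-assoc     : ∀ k l s → Congruence ((k * l) · s) (k · (l · s))
    ·-distribˡ  : ∀ k s t → Congruence (k · (s ⊕ t)) (k · s ⊕ k · t)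
    ·-distribʳ  : ∀ s k l → Congruence ((k + l) · s) (k · s ⊕ l · s)
    ·-zeroˡ     : ∀ s → Congruence (0# · s) 𝟘
    ·-zeroʳ     : ∀ k → Congruence (k · 𝟘) 𝟘

    ⊙-assoc     : ∀ s t u → Congruence ((s ⊙ t) ⊙ u) (s ⊙ (t ⊙ u))
    ⊙-distribˡ  : ∀ s t u → Congruence (s ⊙ (t ⊕ u)) (s ⊙ t ⊕ s ⊙ u)
    ⊙-distribʳ  : ∀ s t u → Congruence ((t ⊕ u) ⊙ s) (t ⊙ s ⊕ u ⊙ s)
    ·-⊙ˡ        : ∀ k s t → Congruence ((k · s) ⊙ t) (k · (s ⊙ t))
    ·-⊙ʳ        : ∀ k s t → Congruence (s ⊙ (k · t)) (k · (s ⊙ t))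

  presentedAlgebra : Algebra K (c ⊔ x) (c ⊔ ℓ ⊔ x ⊔ r)
  presentedAlgebra = record
    { leftModule = record
      { Carrierᴹ = Term K X
      ; _≈ᴹ_ = Congruence
      ; _+ᴹ_ = _⊕_
      ; _*ₗ_ = _·_
      ; 0ᴹ = 𝟘
      ; -ᴹ_ = ⊖_
      ; isLeftModule = record
        { isLeftSemimodule = record
          { +ᴹ-isCommutativeMonoid = record
            { isMonoid = record
              { isSemigroup = record
                { isMagma = record
                  { isEquivalence = record
                    { refl = ≈-refl ; sym = ≈-sym ; trans = ≈-trans }
                  ; ∙-cong = ⊕-cong
                  }
                ; assoc = ⊕-assoc
                }
              ; identity = ⊕-identityˡ
                         , λ s → ≈-trans (⊕-comm s 𝟘) (⊕-identityˡ s)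
              }
            ; comm = ⊕-comm
            }
          ; isPreleftSemimodule = record
            { *ₗ-cong = ·-cong
            ; *ₗ-zeroˡ = ·-zeroˡ
            ; *ₗ-distribʳ = ·-distribʳ
            ; *ₗ-identityˡ = ·-identity
            ; *ₗ-assoc = ·-assoc
            ; *ₗ-zeroʳ = ·-zeroʳ
            ; *ₗ-distribˡ = ·-distribˡ
            }
          }
        ; -ᴹ‿cong = ⊖-cong
        ; -ᴹ‿inverse = ⊖-inverseˡ
                     , λ s → ≈-trans (⊕-comm s (⊖ s)) (⊖-inverseˡ s)
        }
      }
    ; _∙_ = _⊙_
    ; ∙-cong = ⊙-cong
    ; ∙-assoc = ⊙-assoc
    ; ∙-distribˡ = ⊙-distribˡ
    ; ∙-distribʳ = ⊙-distribʳ
    ; *ₗ-∙ˡ = ·-⊙ˡ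
    ; *ₗ-∙ʳ = ·-⊙ʳ
    }

------------------------------------------------------------------------
-- Finite directed graphs

record FiniteDigraph : Set where
  field
    #V #E         : ℕ
    source target : Fin #E → Fin #V

open FiniteDigraph public using (#V; #E)

module _ (G : FiniteDigraph) where
  open FiniteDigraph G hiding (#V; #E)

  IsSink : Fin (#V G) → Set
  IsSink v = ∀ e → source e ≢ v

  IsUniqueSink : Fin (#V G) → Set
  IsUniqueSink v = IsSink v × (∀ w → IsSink w → w ≡ v)

  Step : Rel (Fin (#V G)) _
  Step v w = ∃[ e ] (source e ≡ v × target e ≡ w)

  -- Equality proofs in Fin are unique, so an element of Star Step v w is
  -- determined by its sequence of edges (and by the vertex v when there
  -- are none); different elements are different paths.
  PathTo : Fin (#V G) → Set
  PathTo w = ∃[ v ] Star Step v w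

  Acyclic : Set
  Acyclic = ∀ v → ¬ TransClosure Step v v

  Connected : Set
  Connected = ∀ v w → EqClosure Step v w

------------------------------------------------------------------------
-- Maximal numbers of paths

IsMaximum : (ℕ → Set) → ℕ → Set
IsMaximum P m = P m × (∀ k → P k → k ≤ m)

-- m is the number of finite paths ending in the sink of some connected
-- acyclic directed graph with exactly N edges and exactly one sink.
-- Such a graph is finite, as connectedness bounds its number of vertices.
IsPathCount : ℕ → ℕ → Set
IsPathCount N m =
  Σ[ G ∈ FiniteDigraph ]
    (#E G ≡ N × Connected G × Acyclic G ×
     ∃[ w ] (IsUniqueSink G w × (Fin m ↔ PathTo G w)))

-- s = SP^N_*
IsSP : ℕ → ℕ → Set
IsSP N s = IsMaximum (IsPathCount N) s

-- N = N_n, the maximum of { N | n ≥ SP^N_* }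
IsMaxEdges : ℕ → ℕ → Set
IsMaxEdges n N = IsMaximum (λ M → ∃[ s ] (IsSP M s × s ≤ n)) N

------------------------------------------------------------------------
-- Leavitt path algebras

module _ (K : Field c ℓ) (G : FiniteDigraph) where
  open FiniteDigraph G hiding (#V; #E)

  data Generator : Set where
    vertex     : Fin (#V G) → Generator
    edge ghost : Fin (#E G) → Generator

  private
    𝕍 : Fin (#V G) → Term K Generator
    𝕍 v = gen (vertex v)

    𝔼 𝔼* : Fin (#E G) → Term K Generator
    𝔼 e = gen (edge e)
    𝔼* e = gen (ghost e)

  outgoing : Fin (#V G) → List (Fin (#E G))
  outgoing v = filter (λ e → source e ≟ v) (allFin (#E G))

  data LeavittRelation : Rel (Term K Generator) c where
    vertex-idem       : ∀ v → LeavittRelation (𝕍 v ⊙ 𝕍 v) (𝕍 v)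
    vertex-orthogonal : ∀ {v w} → v ≢ w → LeavittRelation (𝕍 v ⊙ 𝕍 w) 𝟘
    source-edge       : ∀ e → LeavittRelation (𝕍 (source e) ⊙ 𝔼 e) (𝔼 e)
    edge-target       : ∀ e → LeavittRelation (𝔼 e ⊙ 𝕍 (target e)) (𝔼 e)
    target-ghost      : ∀ e → LeavittRelation (𝕍 (target e) ⊙ 𝔼* e) (𝔼* e)
    ghost-source      : ∀ e → LeavittRelation (𝔼* e ⊙ 𝕍 (source e)) (𝔼* e)
    ghost-edge        : ∀ e → LeavittRelation (𝔼* e ⊙ 𝔼 e) (𝕍 (target e))
    ghost-edge-≢      : ∀ {e f} → e ≢ f → LeavittRelation (𝔼* e ⊙ 𝔼 f) 𝟘
    vertex-sum        : ∀ v → ¬ IsSink G v →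
      LeavittRelation (𝕍 v) (foldr _⊕_ 𝟘 (map (λ e → 𝔼 e ⊙ 𝔼* e) (outgoing v)))

  leavittPathAlgebra : Algebra K c (c ⊔ ℓ)
  leavittPathAlgebra = presentedAlgebra K LeavittRelation

{-# OPTIONS --safe #-}
module Submission where

-- Let SP N be the largest value of 1 + a₁ (1 + a₂ (1 + ... (1 + aₖ))) over all
-- ways of writing N as a sum of positive integers a₁, ..., aₖ.  This value is the
-- number of paths into the sink of a chain of k + 1 vertices in which a₁, ..., aₖ
-- parallel edges, counted from the sink, join the consecutive vertices, so it is
-- a path count (chainPathCount).  Conversely let w be a vertex of an acyclic graph
-- with N edges, a of which end at w.  A nonempty path into w consists of one of
-- these a edges, preceded by a path that uses none of them, so by induction there
-- are at most 1 + a SP(N - a) paths into w, which is at most SP N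
-- (pathCount≤SP).  Thus SP N is the maximal number of paths for N edges (isSP).
-- It increases strictly with N, so Nₙ exists, and Nₙ ≤ #E follows once
-- n ≤ SP (#E) is known.
--
-- For this inequality (n≤SP) it suffices that the Leavitt path algebra maps onto
-- the matrix algebra.  Let V x, A e and A* e be the images of the vertices, edges
-- and ghost edges.  Unless x is a sink, V x is the sum of the A e A* e for the
-- edges e leaving x, so if V x is nonzero then V y is nonzero for some successor
-- y.  Following such successors leads to a vertex v with V v nonzero that is a
-- sink or lies on a closed path.  Delete the edges that leave v.  The products of
-- edges along the remaining walks r into v, multiplied by V v, span a subspace S
-- of the matrices, and S is a left ideal:
--
-- * If v is a sink this is a direct consequence of the relations.
--
-- * Otherwise let C be the product of the edges along a path from v that returns
--   to v for the first time at its end, and C* the product of the ghost edges.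
--   Then C* C = V v, and C C* = V v since matrix rings are Dedekind finite
--   (dedekindFinite).  It follows that there is only one such path (unique), and
--   that the corner of all V v X V v commutes with C (corner-commutes).  Hence C
--   is a scalar multiple of V v (central⇒scalar), and S is again a left ideal.
--
-- A closed walk avoiding v would be invertible in its corner, again by Dedekind
-- finiteness, and then no walk to v could leave it.  So no closed walk precedes
-- any of the walks r (acyclicTowards), and the argument above bounds their number
-- by SP (#E) (allWalks).  Finally S contains X V v for all matrices X, so for a
-- nonzero column of V v the space of all n-dimensional columns is spanned by at
-- most SP (#E) of them (spanning-≤).
--
-- Equality in K need not be decidable.  Statements about matrices are therefore
-- often proved up to double negation, which the decidable conclusion n ≤ SP (#E)
-- absorbs.

open import Algebra.Module.Morphism.Structures using (IsLeftModuleIsomorphism)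
import Algebra.Properties.Ring as RingProperties
import Algebra.Properties.Semiring.Sum as SemiringSum
open import Data.Empty using (⊥)
open import Data.Fin.Base
  using (Fin; zero; suc; toℕ; fromℕ<; punchIn; punchOut; splitAt; _↑ˡ_; _↑ʳ_; combine; remQuot)
open import Data.Fin.Properties
  using (_≟_; any?; ¬∀⟶∃¬; pigeonhole; injective⇒≤; punchIn-punchOut; toℕ-injective;
         splitAt-↑ˡ; splitAt-↑ʳ; splitAt⁻¹-↑ˡ; splitAt⁻¹-↑ʳ; ↑ˡ-injective; ↑ʳ-injective;
         remQuot-combine; combine-remQuot)
open import Data.List.Base
  using (List; []; _∷_; _++_; _∷ʳ_; map; foldr; filter; length; lookup; allFin;
         InitLast; initLast; _∷ʳ′_)
open import Data.List.Membership.Propositional using (_∈_)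
open import Data.List.Membership.Propositional.Properties
  using (∈-∃++; ∈-filter⁺; ∈-filter⁻; ∈-map⁺; ∈-length; ∈-allFin; ∈-++⁺ˡ; ∈-++⁺ʳ)
open import Data.List.Properties
  using (length-tabulate; length-map; length-++; ++-conicalʳ; ++-identityʳ;
         ∷-injective; ∷ʳ-injective; map-injective)
open import Data.List.Relation.Unary.All as All using (All; []; _∷_)
import Data.List.Relation.Unary.All.Properties as All
open import Data.List.Relation.Unary.Any using (here; there; index)
open import Data.List.Relation.Unary.Any.Properties using (lookup-index)
open import Data.Nat.Base using (ℕ; zero; suc; _≤_; _<_; z≤n; s≤s; s≤s⁻¹)
open import Data.Nat.Induction using (<-rec; <-wellFounded)
open import Data.Nat.Properties
  using (≤-refl; ≤-trans; ≤-reflexive; ≤-total; <⇒≤; <⇒≱; ≮⇒≥; <-trans; ≤-<-trans;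
         ≤∧≢⇒<; m≤n⇒m<n∨m≡n; n<1+n; m≤m+n; m≤n+m; m∸n≤m; m∸n+n≡m; m+[n∸m]≡n; m+n∸m≡n; _≤?_)
open import Data.Product.Base using (_×_; _,_; ∃-syntax; Σ-syntax; proj₁; proj₂)
open import Data.Sum.Base using (_⊎_; inj₁; inj₂; [_,_]′)
open import Defs
open import Function.Base using (_∘_; const)
open import Function.Bundles using (_↔_; mk↔ₛ′; Inverse; Injection)
open import Function.Properties.Inverse using (↔⇒↣)
open import Induction.WellFounded using (Acc; acc)
open import Level using (_⊔_)
open import Relation.Binary.Construct.Closure.Equivalence using (EqClosure)
import Relation.Binary.Construct.Closure.Equivalence as Eq
open import Relation.Binary.Construct.Closure.ReflexiveTransitive using (Star; ε; _◅_)
open import Relation.Binary.Construct.Closure.Transitive using (TransClosure; [_]; _∷_)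
import Relation.Binary.PropositionalEquality as ≡
open ≡ using (_≡_; _≢_)
import Relation.Binary.Reasoning.Setoid as SetoidReasoning
open import Relation.Nullary.Decidable using (Dec; yes; no; ¬?; _×-dec_; ¬¬-excluded-middle)
open import Relation.Nullary.Negation using (¬_; contradiction)
open import Relation.Unary using (Decidable)

------------------------------------------------------------------------
-- Linear algebra over a field

¬¬-∀ : ∀ {p n} {P : Fin n → Set p} → (∀ i → ¬ ¬ P i) → ¬ ¬ (∀ i → P i)
¬¬-∀ {n = zero}  _  k = k λ ()
¬¬-∀ {n = suc n} ps k = ps zero λ p₀ → ¬¬-∀ (ps ∘ suc) λ ps′ →
  k λ { zero → p₀ ; (suc i) → ps′ i }

module LinearAlgebra {c ℓ} (K : Field c ℓ) where
  open Field K hiding (zero)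
  open SemiringSum semiring
  open RingProperties ring using (-‿distribˡ-*; -‿distribʳ-*)
  open SetoidReasoning setoid

  *-cancel-0 : ∀ {a b} → ¬ (b ≈ 0#) → a * b ≈ 0# → a ≈ 0#
  *-cancel-0 {a} {b} b≉0 ab≈0 with b⁻¹ , bb⁻¹≈1 ← inverse b b≉0 = begin
    a               ≈⟨ *-identityʳ a ⟨
    a * 1#          ≈⟨ *-congˡ bb⁻¹≈1 ⟨
    a * (b * b⁻¹)   ≈⟨ *-assoc a b b⁻¹ ⟨
    (a * b) * b⁻¹   ≈⟨ *-congʳ ab≈0 ⟩
    0# * b⁻¹        ≈⟨ zeroˡ b⁻¹ ⟩
    0#              ∎

  sum-zero : ∀ {n} {f : Fin n → Carrier} → (∀ i → f i ≈ 0#) → sum f ≈ 0#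
  sum-zero {n} f≈0 = trans (sum-cong-≋ f≈0) (sum-replicate-zero n)

  sum-single : ∀ {n} i (f : Fin n → Carrier) → (∀ j → j ≢ i → f j ≈ 0#) → sum f ≈ f i
  sum-single zero    f f≈0 =
    trans (+-congˡ (sum-zero λ j → f≈0 (suc j) λ ())) (+-identityʳ _)
  sum-single (suc i) f f≈0 =
    trans (+-cong (f≈0 zero λ ()) (sum-single i (f ∘ suc) λ j j≢i →
      f≈0 (suc j) λ { ≡.refl → j≢i ≡.refl })) (+-identityˡ _)

  -- A nonzero solution of the homogeneous system A x = 0; nonzero means that some
  -- entry is.
  Kernel : ∀ {m n} → (Fin m → Fin n → Carrier) → Set (c ⊔ ℓ)
  Kernel {m} {n} A = Σ[ x ∈ (Fin n → Carrier) ]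
    ((∃[ j ] ¬ (x j ≈ 0#)) × (∀ (i : Fin m) → ∑[ j < n ] (A i j * x j) ≈ 0#))

  -- Fewer equations than unknowns leave a nonzero solution.  Gaussian elimination:
  -- pick a row p whose first entry is not zero, or take the first unit vector if
  -- there is none.
  kernel : ∀ {m n} → m < n → (A : Fin m → Fin n → Carrier) → ¬ ¬ Kernel A
  kernel {zero} {suc n} _ A k = k ((λ _ → 1#) , (zero , 1≉0) , λ ())
  kernel {suc m} {suc n} (s≤s m<n) A k = ¬¬-excluded-middle {A = ∃[ p ] ¬ (A p zero ≈ 0#)} λ
    { (yes (p , pivot)) → kernel m<n (λ i → reduced p pivot (punchIn p i)) λ
        { (x , (j , xⱼ≉0) , Ax≈0) → k
            ( extend p pivot x
            , (suc j , xⱼ≉0)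
            , λ i → trans (reduce p pivot x i) (row p pivot x Ax≈0 i)) }
    ; (no noPivot) → ¬¬-∀ (λ i Aᵢ₀≉0 → noPivot (i , Aᵢ₀≉0)) λ A₀≈0 → k
        ( (λ { zero → 1# ; (suc _) → 0# })
        , (zero , 1≉0)
        , λ i → trans (+-cong (trans (*-identityʳ _) (A₀≈0 i))
                              (sum-zero {n} λ j → zeroʳ (A i (suc j))))
                      (+-identityˡ 0#)) }
    where
    module _ (p : Fin (suc m)) (pivot : ¬ (A p zero ≈ 0#)) where
      a⁻¹ : Carrier
      a⁻¹ = proj₁ (inverse (A p zero) pivot)

      -- The rows of A after clearing the first column with row p.
      reduced : Fin (suc m) → Fin n → Carrier
      reduced i j = A i (suc j) + - (A i zero * a⁻¹) * A p (suc j)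

      module _ (x : Fin n → Carrier) where
        s : Carrier
        s = ∑[ j < n ] (A p (suc j) * x j)

        extend : Fin (suc n) → Carrier
        extend zero    = - (a⁻¹ * s)
        extend (suc j) = x j

        -- For x extended in this way, row i of the system says the same as row i of
        -- the reduced system.
        reduce : ∀ i → ∑[ j < suc n ] (A i j * extend j) ≈ ∑[ j < n ] (reduced i j * x j)
        reduce i = begin
          A i zero * - (a⁻¹ * s) + ∑[ j < n ] (A i (suc j) * x j)
            ≈⟨ +-comm _ _ ⟩
          ∑[ j < n ] (A i (suc j) * x j) + A i zero * - (a⁻¹ * s)
            ≈⟨ +-congˡ (trans (sym (-‿distribʳ-* _ _))
                 (trans (-‿cong (sym (*-assoc _ _ _))) (-‿distribˡ-* _ _))) ⟩
          ∑[ j < n ] (A i (suc j) * x j) + b * s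
            ≈⟨ +-congˡ (*-distribˡ-sum {n} b _) ⟩
          ∑[ j < n ] (A i (suc j) * x j) + ∑[ j < n ] (b * (A p (suc j) * x j))
            ≈⟨ ∑-distrib-+ {n} _ _ ⟨
          ∑[ j < n ] (A i (suc j) * x j + b * (A p (suc j) * x j))
            ≈⟨ sum-cong-≋ {n} (λ j → trans (+-congˡ (sym (*-assoc _ _ _))) (sym (distribʳ _ _ _))) ⟩
          ∑[ j < n ] (reduced i j * x j) ∎
          where b = - (A i zero * a⁻¹)

        row : (∀ i → ∑[ j < n ] (reduced (punchIn p i) j * x j) ≈ 0#) →
              ∀ i → ∑[ j < n ] (reduced i j * x j) ≈ 0#
        row Ax≈0 i with p ≟ i
        ... | no p≢i = ≡.subst (λ i → ∑[ j < n ] (reduced i j * x j) ≈ 0#)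
                         (punchIn-punchOut p≢i) (Ax≈0 (punchOut p≢i))
        ... | yes ≡.refl = sum-zero {n} λ j → trans (*-congʳ (pivotRow j)) (zeroˡ _)
          where
          pivotRow : ∀ j → reduced p j ≈ 0#
          pivotRow j = begin
            A p (suc j) + - (A p zero * a⁻¹) * A p (suc j)
              ≈⟨ +-congˡ (*-congʳ (-‿cong (proj₂ (inverse (A p zero) pivot)))) ⟩
            A p (suc j) + - 1# * A p (suc j)
              ≈⟨ +-congˡ (trans (sym (-‿distribˡ-* _ _)) (-‿cong (*-identityˡ _))) ⟩
            A p (suc j) + - A p (suc j)
              ≈⟨ -‿inverseʳ _ ⟩
            0# ∎

module Matrices {c ℓ} (K : Field c ℓ) (n : ℕ) where
  open Field K hiding (zero)
  open SemiringSum semiring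
  open RingProperties ring using (x≈y⇒x∙y⁻¹≈ε; x∙y⁻¹≈ε⇒x≈y; -1*x≈-x; -0#≈0#)
  open LinearAlgebra K
  open Algebra (matrixAlgebra K n) public
    using (_≈ᴹ_; _+ᴹ_; -ᴹ_; 0ᴹ; _*ₗ_; _∙_; ∙-cong; ∙-assoc; ∙-distribˡ; ∙-distribʳ; *ₗ-∙ˡ; *ₗ-∙ʳ;
           ≈ᴹ-refl; ≈ᴹ-sym; ≈ᴹ-trans; ≈ᴹ-setoid; +ᴹ-cong; *ₗ-cong; +ᴹ-identityˡ; +ᴹ-identityʳ;
           *ₗ-zeroʳ; *ₗ-assoc; *ₗ-zeroˡ; -ᴹ‿cong)

  private
    Mat : Set c
    Mat = Matrix K n

  ∙-zeroˡ : ∀ X → (0ᴹ ∙ X) ≈ᴹ 0ᴹ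
  ∙-zeroˡ X i j = sum-zero λ k → zeroˡ (X k j)

  ∙-zeroʳ : ∀ X → (X ∙ 0ᴹ) ≈ᴹ 0ᴹ
  ∙-zeroʳ X i j = sum-zero λ k → zeroʳ (X i k)

  ∙-congˡ : ∀ {X Y Z} → Y ≈ᴹ Z → (X ∙ Y) ≈ᴹ (X ∙ Z)
  ∙-congˡ = ∙-cong ≈ᴹ-refl

  ∙-congʳ : ∀ {X Y Z} → Y ≈ᴹ Z → (Y ∙ X) ≈ᴹ (Z ∙ X)
  ∙-congʳ p = ∙-cong p ≈ᴹ-refl

  -- The Kronecker delta.
  δ : Fin n → Fin n → Carrier
  δ i j with i ≟ j
  ... | yes _ = 1#
  ... | no  _ = 0#

  δ-refl : ∀ i → δ i i ≈ 1#
  δ-refl i with i ≟ i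
  ... | yes _   = refl
  ... | no  i≢i = contradiction ≡.refl i≢i

  δ-≢ : ∀ {i j} → i ≢ j → δ i j ≈ 0#
  δ-≢ {i} {j} i≢j with i ≟ j
  ... | yes i≡j = contradiction i≡j i≢j
  ... | no  _   = refl

  -- The matrix unit with its only nonzero entry in row a and column i.
  E : Fin n → Fin n → Mat
  E a i b j = δ b a * δ i j

  E-∙ : ∀ a i X b j → (E a i ∙ X) b j ≈ δ b a * X i j
  E-∙ a i X b j = trans
    (sum-single i _ λ k k≢i →
      trans (*-congʳ (trans (*-congˡ (δ-≢ (k≢i ∘ ≡.sym))) (zeroʳ _))) (zeroˡ _))
    (*-congʳ (trans (*-congˡ (δ-refl i)) (*-identityʳ _)))

  ∙-E-∙ : ∀ X a i Y b j → (X ∙ (E a i ∙ Y)) b j ≈ X b a * Y i j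
  ∙-E-∙ X a i Y b j = trans (sum-cong-≋ λ k → *-congˡ (E-∙ a i Y k j))
    (trans (sum-single a _ λ k k≢a →
              trans (*-congˡ (trans (*-congʳ (δ-≢ k≢a)) (zeroˡ _))) (zeroʳ _))
           (*-congˡ (trans (*-congʳ (δ-refl a)) (*-identityˡ _))))

  nonzeroEntry : ∀ {X} → ¬ (X ≈ᴹ 0ᴹ) → ¬ ¬ (∃[ i ] ∃[ j ] ¬ (X i j ≈ 0#))
  nonzeroEntry X≉0 k = ¬¬-∀ (λ i → ¬¬-∀ λ j Xᵢⱼ≉0 → k (i , j , Xᵢⱼ≉0)) X≉0

  -- The centre of the corner P M P of the matrix algebra M consists of multiples
  -- of P.  Comparing entries of X P E P = P E P X for matrix units E gives
  -- X a i * P j b = P a i * X j b, where P j b can be chosen nonzero.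
  central⇒scalar : ∀ {P X} → (X ∙ P) ≈ᴹ X → (P ∙ X) ≈ᴹ X → ¬ (P ≈ᴹ 0ᴹ) →
    (∀ Y → (X ∙ (P ∙ (Y ∙ P))) ≈ᴹ ((P ∙ (Y ∙ P)) ∙ X)) → ¬ ¬ (∃[ k ] X ≈ᴹ (k *ₗ P))
  central⇒scalar {P} {X} XP≈X PX≈X P≉0 commutes k = nonzeroEntry P≉0 λ (j , b , Pⱼᵦ≉0) →
    let p , Pⱼᵦp≈1 = inverse _ Pⱼᵦ≉0 in
    k (X j b * p , λ a i → begin
      X a i                     ≈⟨ *-identityʳ _ ⟨
      X a i * 1#                ≈⟨ *-congˡ Pⱼᵦp≈1 ⟨
      X a i * (P j b * p)       ≈⟨ *-assoc _ _ _ ⟨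
      X a i * P j b * p         ≈⟨ *-congʳ (entries j b a i) ⟩
      P a i * X j b * p         ≈⟨ *-assoc _ _ _ ⟩
      P a i * (X j b * p)       ≈⟨ *-comm _ _ ⟩
      X j b * p * P a i         ∎)
    where
    open SetoidReasoning setoid
    entries : ∀ j b a i → X a i * P j b ≈ P a i * X j b
    entries j b a i = begin
      X a i * P j b                   ≈⟨ ∙-E-∙ X i j P a b ⟨
      (X ∙ (E i j ∙ P)) a b           ≈⟨ ∙-congʳ {E i j ∙ P} XP≈X a b ⟨
      ((X ∙ P) ∙ (E i j ∙ P)) a b     ≈⟨ ∙-assoc X P (E i j ∙ P) a b ⟩
      (X ∙ (P ∙ (E i j ∙ P))) a b     ≈⟨ commutes (E i j) a b ⟩
      ((P ∙ (E i j ∙ P)) ∙ X) a b     ≈⟨ ∙-assoc P (E i j ∙ P) X a b ⟩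
      (P ∙ ((E i j ∙ P) ∙ X)) a b     ≈⟨ ∙-congˡ {P} (∙-assoc (E i j) P X) a b ⟩
      (P ∙ (E i j ∙ (P ∙ X))) a b     ≈⟨ ∙-congˡ {P} (∙-congˡ {E i j} PX≈X) a b ⟩
      (P ∙ (E i j ∙ X)) a b           ≈⟨ ∙-E-∙ P i j X a b ⟩
      P a i * X j b                   ∎

  -- The linear span of the matrices satisfying B.
  data Span {b} (B : Mat → Set b) : Mat → Set (b ⊔ c ⊔ ℓ) where
    base  : ∀ {X} → B X → Span B X
    resp  : ∀ {X Y} → X ≈ᴹ Y → Span B X → Span B Y
    zero  : Span B 0ᴹ
    add   : ∀ {X Y} → Span B X → Span B Y → Span B (X +ᴹ Y)
    scale : ∀ k {X} → Span B X → Span B (k *ₗ X)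

  -- If P is nonzero and the matrices Y P lie in the span of m matrices, then m is at
  -- least n.  Otherwise some nonzero functional ξ kills the j-th columns of these
  -- matrices, and hence of all Y P; but for P i j nonzero, ξ does not kill
  -- all the j-th columns of the products of matrix units with P.
  spanning-≤ : ∀ {b} {B : Mat → Set b} {m} (W : Fin m → Mat) →
    (∀ {X} → B X → ∃[ i ] ∃[ k ] X ≈ᴹ (k *ₗ W i)) →
    ∀ {P} → ¬ (P ≈ᴹ 0ᴹ) → (∀ Y → Span B (Y ∙ P)) → ¬ (m < n)
  spanning-≤ {B = B} {m} W B⊆W {P} P≉0 spans m<n = nonzeroEntry P≉0 λ (i , j , Pᵢⱼ≉0) →
    kernel m<n (λ k a → W k a j) λ (ξ , (a , ξₐ≉0) , ξW≈0) →
      ξₐ≉0 (*-cancel-0 Pᵢⱼ≉0 (begin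
        ξ a * P i j           ≈⟨ *-comm _ _ ⟩
        P i j * ξ a           ≈⟨ *-congʳ (trans (*-congʳ (δ-refl a)) (*-identityˡ _)) ⟨
        δ a a * P i j * ξ a   ≈⟨ sum-single {n} a _ (λ b b≢a →
                                   trans (*-congʳ (trans (*-congʳ (δ-≢ b≢a)) (zeroˡ _))) (zeroˡ _)) ⟨
        ∑[ b < n ] (δ b a * P i j * ξ b)     ≈⟨ sum-cong-≋ {n} (λ b → *-congʳ (E-∙ a i P b j)) ⟨
        ∑[ b < n ] ((E a i ∙ P) b j * ξ b)   ≈⟨ vanishes j ξ ξW≈0 (spans (E a i)) ⟩
        0#                    ∎))
    where
    open SetoidReasoning setoid
    module _ (j : Fin n) (ξ : Fin n → Carrier)
             (ξW≈0 : ∀ k → ∑[ a < n ] (W k a j * ξ a) ≈ 0#) where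
      vanishes : ∀ {X} → Span B X → ∑[ a < n ] (X a j * ξ a) ≈ 0#
      scaled : ∀ k {X} → ∑[ a < n ] (X a j * ξ a) ≈ 0# → ∑[ a < n ] (k * X a j * ξ a) ≈ 0#
      scaled k {X} p = trans (sum-cong-≋ {n} λ a → *-assoc _ _ _)
        (trans (sym (*-distribˡ-sum {n} k _)) (trans (*-congˡ p) (zeroʳ k)))
      vanishes (base X∈B) with i , k , X≈kW ← B⊆W X∈B =
        trans (sum-cong-≋ {n} λ a → *-congʳ (X≈kW a j)) (scaled k {W i} (ξW≈0 i))
      vanishes (resp X≈Y s) = trans (sum-cong-≋ {n} λ a → *-congʳ (sym (X≈Y a j))) (vanishes s)
      vanishes zero = sum-zero {n} λ a → zeroˡ _
      vanishes (add {X} {Y} s t) = trans (sum-cong-≋ {n} λ a → distribʳ _ _ _)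
        (trans (∑-distrib-+ {n} (λ a → X a j * ξ a) (λ a → Y a j * ξ a))
          (trans (+-cong (vanishes s) (vanishes t)) (+-identityˡ 0#)))
      vanishes (scale k {X} s) = scaled k {X} (vanishes s)

  -- If Z annihilates all but the i-th of the matrices U, then multiplying a linear
  -- relation between their j-th columns by Z isolates its i-th coefficient.
  separate : ∀ {m} (U : Fin m → Mat) Z i → (∀ l → l ≢ i → (Z ∙ U l) ≈ᴹ 0ᴹ) →
    ∀ (x : Fin m → Carrier) j → (∀ a → ∑[ l < m ] (U l a j * x l) ≈ 0#) →
    ∀ b → (Z ∙ U i) b j * x i ≈ 0#
  separate {m} U Z i ZU≈0 x j dependent b = begin
    (Z ∙ U i) b j * x i
      ≈⟨ sum-single {m} i _ (λ l l≢i → trans (*-congʳ (ZU≈0 l l≢i b j)) (zeroˡ (x l))) ⟨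
    ∑[ l < m ] ((Z ∙ U l) b j * x l)
      ≈⟨ sum-cong-≋ {m} (λ l → *-distribʳ-sum {n} (x l) _) ⟩
    ∑[ l < m ] ∑[ a < n ] (Z b a * U l a j * x l)
      ≈⟨ ∑-comm {m} {n} _ ⟩
    ∑[ a < n ] ∑[ l < m ] (Z b a * U l a j * x l)
      ≈⟨ sum-cong-≋ {n} (λ a → trans (sum-cong-≋ {m} λ l → *-assoc (Z b a) (U l a j) (x l))
           (sym (*-distribˡ-sum {m} (Z b a) _))) ⟩
    ∑[ a < n ] (Z b a * ∑[ l < m ] (U l a j * x l))
      ≈⟨ sum-zero {n} (λ a → trans (*-congˡ (dependent a)) (zeroʳ (Z b a))) ⟩
    0# ∎
    where open SetoidReasoning setoid

  -- A one-sided inverse in the corner of an idempotent P is two-sided.  Let Q be the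
  -- idempotent P - D D*, so that D* Q = 0 = Q D.  The matrices Q, D Q, D² Q, ... are
  -- separated by Q, Q D*, Q D*², ..., so if Q were nonzero some column of them would
  -- give infinitely many independent vectors.
  module _ {P D D* : Mat}
    (PP≈P : (P ∙ P) ≈ᴹ P) (PD≈D : (P ∙ D) ≈ᴹ D) (DP≈D : (D ∙ P) ≈ᴹ D)
    (PD*≈D* : (P ∙ D*) ≈ᴹ D*) (D*P≈D* : (D* ∙ P) ≈ᴹ D*) (D*D≈P : (D* ∙ D) ≈ᴹ P) where

    private
      open SetoidReasoning ≈ᴹ-setoid

      Q : Mat
      Q = P +ᴹ (-ᴹ (D ∙ D*))

      cancel : ∀ {X Y} → X ≈ᴹ Y → (X +ᴹ (-ᴹ Y)) ≈ᴹ 0ᴹ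
      cancel X≈Y i j = x≈y⇒x∙y⁻¹≈ε (X≈Y i j)

      ∙-neg : ∀ X Y → (X ∙ (-ᴹ Y)) ≈ᴹ (-ᴹ (X ∙ Y))
      ∙-neg X Y = begin
        X ∙ (-ᴹ Y)             ≈⟨ ∙-congˡ (λ i j → sym (-1*x≈-x (Y i j))) ⟩
        X ∙ ((- 1#) *ₗ Y)      ≈⟨ *ₗ-∙ʳ (- 1#) X Y ⟩
        (- 1#) *ₗ (X ∙ Y)      ≈⟨ (λ i j → -1*x≈-x ((X ∙ Y) i j)) ⟩
        -ᴹ (X ∙ Y)             ∎

      neg-∙ : ∀ X Y → ((-ᴹ X) ∙ Y) ≈ᴹ (-ᴹ (X ∙ Y))
      neg-∙ X Y = begin
        (-ᴹ X) ∙ Y             ≈⟨ ∙-congʳ {Y} (λ i j → sym (-1*x≈-x (X i j))) ⟩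
        ((- 1#) *ₗ X) ∙ Y      ≈⟨ *ₗ-∙ˡ (- 1#) X Y ⟩
        (- 1#) *ₗ (X ∙ Y)      ≈⟨ (λ i j → -1*x≈-x ((X ∙ Y) i j)) ⟩
        -ᴹ (X ∙ Y)             ∎

      ∙-Q : ∀ X → (X ∙ Q) ≈ᴹ ((X ∙ P) +ᴹ (-ᴹ ((X ∙ D) ∙ D*)))
      ∙-Q X = ≈ᴹ-trans (∙-distribˡ X P _) (+ᴹ-cong (≈ᴹ-refl {X ∙ P}) (≈ᴹ-trans (∙-neg X _)
        (-ᴹ‿cong (≈ᴹ-sym (∙-assoc X D D*)))))

      D*Q≈0 : (D* ∙ Q) ≈ᴹ 0ᴹ
      D*Q≈0 = ≈ᴹ-trans (∙-Q D*)
        (cancel (≈ᴹ-trans D*P≈D* (≈ᴹ-sym (≈ᴹ-trans (∙-congʳ D*D≈P) PD*≈D*))))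

      PQ≈Q : (P ∙ Q) ≈ᴹ Q
      PQ≈Q = ≈ᴹ-trans (∙-Q P) (+ᴹ-cong PP≈P (-ᴹ‿cong (∙-congʳ PD≈D)))

      QD≈0 : (Q ∙ D) ≈ᴹ 0ᴹ
      QD≈0 = ≈ᴹ-trans (∙-distribʳ D P _) (≈ᴹ-trans (+ᴹ-cong PD≈D (neg-∙ (D ∙ D*) D))
        (cancel (≈ᴹ-sym (≈ᴹ-trans (∙-assoc D D* D) (≈ᴹ-trans (∙-congˡ D*D≈P) DP≈D)))))

      QP≈Q : (Q ∙ P) ≈ᴹ Q
      QP≈Q = ≈ᴹ-trans (∙-distribʳ P P _) (+ᴹ-cong PP≈P (≈ᴹ-trans (neg-∙ (D ∙ D*) P)
        (-ᴹ‿cong (≈ᴹ-trans (∙-assoc D D* P) (∙-congˡ D*P≈D*)))))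

      QQ≈Q : (Q ∙ Q) ≈ᴹ Q
      QQ≈Q = begin
        Q ∙ Q                                  ≈⟨ ∙-Q Q ⟩
        (Q ∙ P) +ᴹ (-ᴹ ((Q ∙ D) ∙ D*))         ≈⟨ +ᴹ-cong QP≈Q (-ᴹ‿cong (≈ᴹ-trans (∙-congʳ QD≈0) (∙-zeroˡ D*))) ⟩
        Q +ᴹ (-ᴹ 0ᴹ)                           ≈⟨ +ᴹ-cong (≈ᴹ-refl {Q}) (λ _ _ → -0#≈0#) ⟩
        Q +ᴹ 0ᴹ                                ≈⟨ +ᴹ-identityʳ Q ⟩
        Q                                      ∎

      -- up k is Dᵏ Q and down k is Q D*ᵏ.
      up down : ℕ → Mat
      up zero      = Q
      up (suc k)   = D ∙ up k
      down zero    = Q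
      down (suc k) = down k ∙ D*

      P-up : ∀ k → (P ∙ up k) ≈ᴹ up k
      P-up zero    = PQ≈Q
      P-up (suc k) = ≈ᴹ-trans (≈ᴹ-sym (∙-assoc P D (up k))) (∙-congʳ PD≈D)

      down-up-suc : ∀ i j → (down (suc i) ∙ up (suc j)) ≈ᴹ (down i ∙ up j)
      down-up-suc i j = begin
        (down i ∙ D*) ∙ (D ∙ up j)    ≈⟨ ∙-assoc (down i) D* _ ⟩
        down i ∙ (D* ∙ (D ∙ up j))    ≈⟨ ∙-congˡ (∙-assoc D* D (up j)) ⟨
        down i ∙ ((D* ∙ D) ∙ up j)    ≈⟨ ∙-congˡ (∙-congʳ D*D≈P) ⟩
        down i ∙ (P ∙ up j)           ≈⟨ ∙-congˡ (P-up j) ⟩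
        down i ∙ up j                 ∎

      down-up : ∀ i → (down i ∙ up i) ≈ᴹ Q
      down-up zero    = QQ≈Q
      down-up (suc i) = ≈ᴹ-trans (down-up-suc i i) (down-up i)

      down-up-≢ : ∀ i j → i ≢ j → (down i ∙ up j) ≈ᴹ 0ᴹ
      down-up-≢ zero    zero    i≢j = contradiction ≡.refl i≢j
      down-up-≢ zero    (suc j) _   =
        ≈ᴹ-trans (≈ᴹ-sym (∙-assoc Q D (up j))) (≈ᴹ-trans (∙-congʳ QD≈0) (∙-zeroˡ (up j)))
      down-up-≢ (suc i) zero    _   =
        ≈ᴹ-trans (∙-assoc (down i) D* Q) (≈ᴹ-trans (∙-congˡ D*Q≈0) (∙-zeroʳ (down i)))
      down-up-≢ (suc i) (suc j) i≢j =
        ≈ᴹ-trans (down-up-suc i j) (down-up-≢ i j (i≢j ∘ ≡.cong suc))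

      -- The j-th columns of the n + 1 matrices up k are dependent.
      Q-column : ∀ j → ¬ ¬ (∀ b → Q b j ≈ 0#)
      Q-column j k = kernel (n<1+n n) (λ a l → up (toℕ l) a j) λ (x , (i , xᵢ≉0) , dependent) →
        k λ b → *-cancel-0 xᵢ≉0 (trans (*-congʳ (sym (down-up (toℕ i) b j)))
          (separate (up ∘ toℕ) (down (toℕ i)) i
            (λ l l≢i → down-up-≢ (toℕ i) (toℕ l) (l≢i ∘ toℕ-injective ∘ ≡.sym))
            x j dependent b))

    dedekindFinite : ¬ ¬ ((D ∙ D*) ≈ᴹ P)
    dedekindFinite k = ¬¬-∀ Q-column λ Q≈0 →
      k λ b j → sym (x∙y⁻¹≈ε⇒x≈y _ _ (Q≈0 j b))

open ≡ using (refl; sym; trans; cong; cong₂; subst)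
open Data.Nat.Base using (_+_; _*_; _∸_)
open Data.Nat.Properties using (+-identityʳ; +-suc; +-mono-≤; +-monoˡ-≤; *-monoʳ-≤)

------------------------------------------------------------------------
-- Chains of bundles of parallel edges

-- ChainCount N s: some chain of vertices, each joined to the next by at least one
-- edge, has N edges in all and s paths into its last vertex.  The constructor
-- extend appends a new last vertex, joined to the old one by a + 1 parallel edges:
-- a path into it is empty, or one of the s old paths followed by a new edge.
data ChainCount : ℕ → ℕ → Set where
  point  : ChainCount 0 1
  extend : ∀ {N s} a → ChainCount N s → ChainCount (suc a + N) (suc (suc a * s))

argmax : (f : ℕ → ℕ) → ∀ b → ∃[ m ] (m ≤ b × (∀ {k} → k ≤ b → f k ≤ f m))
argmax f zero = zero , z≤n , λ { z≤n → ≤-refl }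
argmax f (suc b) with m , m≤b , best ← argmax f b with ≤-total (f (suc b)) (f m)
... | inj₁ f≤fm = m , ≤-trans m≤b (<⇒≤ (n<1+n b)) , λ k≤ →
  bestUpTo (m≤n⇒m<n∨m≡n k≤)
  where
  bestUpTo : ∀ {k} → k < suc b ⊎ k ≡ suc b → f k ≤ f m
  bestUpTo (inj₁ k<)   = best (s≤s⁻¹ k<)
  bestUpTo (inj₂ refl) = f≤fm
... | inj₂ fm≤f = suc b , ≤-refl , λ k≤ → bestUpTo (m≤n⇒m<n∨m≡n k≤)
  where
  bestUpTo : ∀ {k} → k < suc b ⊎ k ≡ suc b → f k ≤ f (suc b)
  bestUpTo (inj₁ k<)   = ≤-trans (best (s≤s⁻¹ k<)) fm≤f
  bestUpTo (inj₂ refl) = ≤-refl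

chainMaximum : ∀ N → ∃[ s ] IsMaximum (ChainCount N) s
chainMaximum = <-rec _ maximum
  where
  maximum : ∀ N → (∀ {M} → M < N → ∃[ s ] IsMaximum (ChainCount M) s) →
            ∃[ s ] IsMaximum (ChainCount N) s
  maximum zero    _   = 1 , point , λ { _ point → ≤-refl }
  maximum (suc N) rec =
    let m , m≤N , best = argmax (λ a → suc (suc a * proj₁ (shorter a))) N in
    suc (suc m * proj₁ (shorter m))
    , subst (λ M → ChainCount (suc M) (suc (suc m * proj₁ (shorter m)))) (m+[n∸m]≡n m≤N)
        (extend m (proj₁ (proj₂ (shorter m))))
    , λ { _ (extend {M} a c) → ≤-trans (bound a c refl) (best (m≤m+n a M)) }
    where
    -- The best chain on N - a edges, to be extended by a + 1 parallel edges.
    shorter : ∀ a → ∃[ s ] IsMaximum (ChainCount (N ∸ a)) s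
    shorter a = rec (s≤s (m∸n≤m N a))

    bound : ∀ a {M s} → ChainCount M s → a + M ≡ N →
            suc (suc a * s) ≤ suc (suc a * proj₁ (shorter a))
    bound a {M} {s} c refl = s≤s (*-monoʳ-≤ (suc a) (proj₂ (proj₂ (shorter a)) s
      (subst (λ M → ChainCount M s) (sym (m+n∸m≡n a M)) c)))

-- The maximum number of paths in a chain with N edges; by isSP below, this is the
-- maximum over all the graphs considered.
SP : ℕ → ℕ
SP N = proj₁ (chainMaximum N)

SP-chain : ∀ N → ChainCount N (SP N)
SP-chain N = proj₁ (proj₂ (chainMaximum N))

SP-max : ∀ {N s} → ChainCount N s → s ≤ SP N
SP-max {N} {s} = proj₂ (proj₂ (chainMaximum N)) s

SP-step : ∀ N → SP N < SP (suc N)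
SP-step N = subst (_< SP (suc N)) (+-identityʳ (SP N)) (SP-max (extend 0 (SP-chain N)))

SP-0 : SP 0 ≡ 1
SP-0 with SP 0 | SP-chain 0
... | _ | point = refl

1≤SP : ∀ N → 1 ≤ SP N
1≤SP zero    = SP-max point
1≤SP (suc N) = ≤-trans (s≤s z≤n) (SP-step N)

SP-mono-< : ∀ {M N} → M < N → SP M < SP N
SP-mono-< {M} {suc N} M<N with m≤n⇒m<n∨m≡n (s≤s⁻¹ M<N)
... | inj₁ M<N′ = <-trans (SP-mono-< M<N′) (SP-step N)
... | inj₂ refl = SP-step M

N<SP : ∀ N → N < SP N
N<SP zero    = 1≤SP 0
N<SP (suc N) = ≤-<-trans (N<SP N) (SP-step N)

SP-bundle : ∀ a N → suc (a * SP N) ≤ SP (a + N)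
SP-bundle zero    N = 1≤SP N
SP-bundle (suc a) N = SP-max (extend a (SP-chain N))

------------------------------------------------------------------------
-- Chains as graphs

module _ {G : FiniteDigraph} where

  edges : ∀ {x y} → Star (Step G) x y → List (Fin (#E G))
  edges ε             = []
  edges ((e , _) ◅ p) = e ∷ edges p

  edges-injective : ∀ {x y w} (p : Star (Step G) x w) (q : Star (Step G) y w) →
    edges p ≡ edges q → _≡_ {A = PathTo G w} (x , p) (y , q)
  edges-injective ε                      ε                      _  = refl
  edges-injective ((_ , refl , refl) ◅ p) ((_ , refl , refl) ◅ q) eq
    with refl , eq′ ← ∷-injective eq with refl ← edges-injective p q eq′ = refl

-- The graph G with a new vertex, zero, and a + 1 parallel edges from w to it.  The
-- new edges come first.
addSink : (G : FiniteDigraph) → Fin (#V G) → ℕ → FiniteDigraph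
addSink G w a = record
  { #V = suc (#V G)
  ; #E = suc a + #E G
  ; source = [ const (suc w) , suc ∘ FiniteDigraph.source G ]′ ∘ splitAt (suc a)
  ; target = [ const zero , suc ∘ FiniteDigraph.target G ]′ ∘ splitAt (suc a)
  }

module _ (G : FiniteDigraph) (w : Fin (#V G)) (a : ℕ) where
  private
    G⁺ : FiniteDigraph
    G⁺ = addSink G w a
    module G = FiniteDigraph G
    module G⁺ = FiniteDigraph G⁺

  newStep : Fin (suc a) → Step G⁺ (suc w) zero
  newStep i = i ↑ˡ #E G
            , cong [ _ , _ ]′ (splitAt-↑ˡ (suc a) i (#E G))
            , cong [ _ , _ ]′ (splitAt-↑ˡ (suc a) i (#E G))

  oldStep : ∀ {x y} → Step G x y → Step G⁺ (suc x) (suc y)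
  oldStep (e , refl , refl) = suc a ↑ʳ e
                            , cong [ _ , _ ]′ (splitAt-↑ʳ (suc a) (#E G) e)
                            , cong [ _ , _ ]′ (splitAt-↑ʳ (suc a) (#E G) e)

  -- Every step of the larger graph is a new or an old one.
  data View : ∀ {x y} → Step G⁺ x y → Set where
    new : ∀ i → View (newStep i)
    old : ∀ {x y} (s : Step G x y) → View (oldStep s)

  step-≡ : ∀ {x y} {s s′ : Step G⁺ x y} → proj₁ s ≡ proj₁ s′ → s ≡ s′
  step-≡ {s = _ , refl , refl} {_ , refl , refl} refl = refl

  view : ∀ {x y} (s : Step G⁺ x y) → View s
  view (e , p , q) = go (splitAt (suc a) e) refl p q
    where
    go : ∀ {e x y} z → splitAt (suc a) e ≡ z → (p : G⁺.source e ≡ x) (q : G⁺.target e ≡ y) →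
         View (e , p , q)
    go {e} (inj₁ i) eq p q
      with refl ← splitAt⁻¹-↑ˡ {m = suc a} {i = e} eq
      with refl ← trans (sym p) (proj₁ (proj₂ (newStep i)))
         | refl ← trans (sym q) (proj₂ (proj₂ (newStep i))) =
      subst View (step-≡ refl) (new i)
    go {e} (inj₂ f) eq p q
      with refl ← splitAt⁻¹-↑ʳ {m = suc a} {i = e} eq
      with refl ← trans (sym p) (proj₁ (proj₂ (oldStep (f , refl , refl))))
         | refl ← trans (sym q) (proj₂ (proj₂ (oldStep (f , refl , refl)))) =
      subst View (step-≡ refl) (old (f , refl , refl))

  Connected⁺ : Connected G → Connected G⁺
  Connected⁺ conn x y = Eq.transitive _ (toNew x) (Eq.symmetric _ (toNew y))
    where
    toNew : ∀ x → EqClosure (Step G⁺) x zero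
    toNew zero    = ε
    toNew (suc x) = Eq.transitive _
      (Eq.gmap suc oldStep (conn x w)) (Eq.return (newStep zero))

  fromNew : ∀ {y} → ¬ Step G⁺ zero y
  fromNew s = go s refl
    where
    go : ∀ {x y} → Step G⁺ x y → x ≢ zero
    go s with view s
    ... | new i = λ ()
    ... | old s = λ ()

  Acyclic⁺ : Acyclic G → Acyclic G⁺
  Acyclic⁺ acyclic zero    p = fromFirst p
    where
    fromFirst : ∀ {y} → ¬ TransClosure (Step G⁺) zero y
    fromFirst [ s ]   = fromNew s
    fromFirst (s ∷ _) = fromNew s
  Acyclic⁺ acyclic (suc x) p = acyclic x (restrict p refl refl)
    where
    restrict : ∀ {x y u v} → TransClosure (Step G⁺) x y → x ≡ suc u → y ≡ suc v →
               TransClosure (Step G) u v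
    restrict [ s ] p q with view s
    restrict [ s ] refl refl | old s′ = [ s′ ]
    restrict (s ∷ r) p q with view s
    restrict (s ∷ r) refl refl | old s′ = s′ ∷ restrict r refl refl
    restrict (s ∷ r) p refl | new i with r
    ... | [ t ]   = contradiction t fromNew
    ... | t ∷ _   = contradiction t fromNew

  new-unique : IsUniqueSink G w → IsUniqueSink G⁺ zero
  new-unique w-unique = (λ e p → fromNew (e , p , refl)) , unique
    where
    unique : ∀ x → IsSink G⁺ x → x ≡ zero
    unique zero    _    = refl
    unique (suc x) sink with proj₂ w-unique x (λ e p →
      let f , q , _ = oldStep (e , p , refl) in sink f q)
    ... | refl = contradiction (proj₁ (proj₂ (newStep zero))) (sink (proj₁ (newStep zero)))

  -- An old path into w followed by the i-th new edge.
  append : ∀ {x} → Star (Step G) x w → Fin (suc a) → Star (Step G⁺) (suc x) zero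
  append ε       i = newStep i ◅ ε
  append (s ◅ p) i = oldStep s ◅ append p i

  edges-append : ∀ {x} (p : Star (Step G) x w) i →
    edges (append p i) ≡ map (suc a ↑ʳ_) (edges p) ∷ʳ (i ↑ˡ #E G)
  edges-append ε                         i = refl
  edges-append ((_ , refl , refl) ◅ p) i = cong (_ ∷_) (edges-append p i)

  -- Every path into the new sink is empty or arises by append.
  data PathView : ∀ {x} → Star (Step G⁺) x zero → Set where
    stay  : PathView ε
    leave : ∀ {x} (p : Star (Step G) x w) i → PathView (append p i)

  pathView : ∀ {x} (p : Star (Step G⁺) x zero) → PathView p
  pathView ε = stay
  pathView (s ◅ p) with view s
  pathView (_ ◅ ε)     | new i = leave ε i
  pathView (_ ◅ t ◅ _) | new i = contradiction t fromNew
  pathView (_ ◅ p)     | old s with pathView p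
  ... | leave p i = leave (s ◅ p) i

  appendTo : Fin (suc a) → PathTo G w → PathTo G⁺ zero
  appendTo i (x , p) = suc x , append p i

  appendTo-injective : ∀ {i j p q} → appendTo i p ≡ appendTo j q → i ≡ j × p ≡ q
  appendTo-injective {i} {j} {_ , p} {_ , q} eq
    with es , i≡j ← ∷ʳ-injective _ _
           (trans (sym (edges-append p i)) (trans (cong (edges ∘ proj₂) eq) (edges-append q j))) =
    ↑ˡ-injective _ _ _ i≡j , edges-injective p q (map-injective (↑ʳ-injective _ _ _) es)

  module _ {m} (count : Fin m ↔ PathTo G w) where
    open Inverse count

    decodePair : Fin (suc a) × Fin m → PathTo G⁺ zero
    decodePair (i , j) = appendTo i (to j)

    -- The number zero stands for the empty path, and suc k for the pair of a new edge
    -- and an old path that k encodes.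
    decode : Fin (suc (suc a * m)) → PathTo G⁺ zero
    decode zero    = zero , ε
    decode (suc k) = decodePair (remQuot m k)

    encodeView : ∀ {x} {p : Star (Step G⁺) x zero} → PathView p → Fin (suc (suc a * m))
    encodeView stay        = zero
    encodeView (leave p i) = suc (combine i (from (_ , p)))

    encode : PathTo G⁺ zero → Fin (suc (suc a * m))
    encode (_ , p) = encodeView (pathView p)

    decode-encode : ∀ p → decode (encode p) ≡ p
    decode-encode (_ , p) with pathView p
    ... | stay = refl
    ... | leave p i = trans (cong decodePair (remQuot-combine i (from (_ , p))))
                             (cong (appendTo i) (strictlyInverseˡ (_ , p)))

    decode-injective : ∀ k l → decode k ≡ decode l → k ≡ l
    decode-injective zero    zero    _  = refl
    decode-injective (suc k) (suc l) eq
      with i≡j , p≡q ← appendTo-injective eq =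
      cong suc (trans (sym (combine-remQuot m k))
        (trans (cong₂ combine i≡j (Injection.injective (↔⇒↣ count) p≡q)) (combine-remQuot m l)))

    count⁺ : Fin (suc (suc a * m)) ↔ PathTo G⁺ zero
    count⁺ = mk↔ₛ′ decode encode decode-encode λ k →
      decode-injective _ _ (decode-encode (decode k))

chainPathCount : ∀ {N s} → ChainCount N s → IsPathCount N s
chainPathCount point = pt , refl , connected , acyclic , zero , unique , count
  where
  pt : FiniteDigraph
  pt = record { #V = 1 ; #E = 0 ; source = λ () ; target = λ () }

  connected : Connected pt
  connected zero zero = ε

  acyclic : Acyclic pt
  acyclic _ [ () , _ ]
  acyclic _ ((() , _) ∷ _)

  unique : IsUniqueSink pt zero
  unique = (λ ()) , λ { zero _ → refl }

  count : Fin 1 ↔ PathTo pt zero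
  count = mk↔ₛ′ (λ _ → zero , ε) (λ _ → zero)
    (λ { (zero , ε) → refl ; (_ , (() , _) ◅ _) }) (λ { zero → refl })
chainPathCount (extend a c) with chainPathCount c
... | G , refl , connected , acyclic , w , unique , count =
  addSink G w a , refl , Connected⁺ G w a connected ,
  Acyclic⁺ G w a acyclic , zero , new-unique G w a unique ,
  count⁺ G w a count

------------------------------------------------------------------------
-- Walks ending at a vertex, and the upper bound

length-filter-¬ : ∀ {a p} {A : Set a} {P : A → Set p} (P? : Decidable P) xs →
  length (filter P? xs) + length (filter (¬? ∘ P?) xs) ≡ length xs
length-filter-¬ P? []       = refl
length-filter-¬ P? (x ∷ xs) with P? x
... | yes _ = cong suc (length-filter-¬ P? xs)
... | no  _ = trans (+-suc _ _) (cong suc (length-filter-¬ P? xs))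

-- If for each of the elements x of xs at most k elements y satisfy P x y, then at
-- most length xs * k elements satisfy it for some x in xs.
gather : ∀ {a b p} {A : Set a} {B : Set b} {P : A → B → Set p} {k} {xs : List A} →
  All (λ x → ∃[ ys ] (length ys ≤ k × (∀ {y} → P x y → y ∈ ys))) xs →
  ∃[ ys ] (length ys ≤ length xs * k × (∀ {x y} → x ∈ xs → P x y → y ∈ ys))
gather [] = [] , z≤n , λ ()
gather {P = P} ((ys , ys≤ , complete) ∷ rest) with gather {P = P} rest
... | zs , zs≤ , complete′ =
  ys ++ zs
  , ≤-trans (≤-reflexive (length-++ ys)) (+-mono-≤ ys≤ zs≤)
  , λ { (here refl) p → ∈-++⁺ˡ (complete p)
      ; (there x∈)  p → ∈-++⁺ʳ ys (complete′ x∈ p) }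

-- Walks that may only visit v at their end: the paths of the graph from which the
-- edges leaving v are deleted.  If v is a sink they are all the paths.
module Walks (G : FiniteDigraph) (v : Fin (#V G)) where
  open FiniteDigraph G hiding (#V; #E)

  -- IsWalk x r y: the edges r, in this order, form such a walk from x to y.
  IsWalk : Fin (#V G) → List (Fin (#E G)) → Fin (#V G) → Set
  IsWalk x []      y = x ≡ y
  IsWalk x (e ∷ r) y = source e ≡ x × x ≢ v × IsWalk (target e) r y

  walk-++ : ∀ {x y z} r {s} → IsWalk x r y → IsWalk y s z → IsWalk x (r ++ s) z
  walk-++ []      refl        q = q
  walk-++ (e ∷ r) (p , x≢v , w) q = p , x≢v , walk-++ r w q

  walk-split : ∀ {x z} r {s} → IsWalk x (r ++ s) z → ∃[ y ] (IsWalk x r y × IsWalk y s z)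
  walk-split []      w = _ , refl , w
  walk-split (e ∷ r) (p , x≢v , w) with walk-split r w
  ... | y , w₁ , w₂ = y , (p , x≢v , w₁) , w₂

  -- A walk into y, from anywhere, that uses only edges from es.
  WalkIn : List (Fin (#E G)) → Fin (#V G) → List (Fin (#E G)) → Set
  WalkIn es y r = ∃[ x ] (IsWalk x r y × All (_∈ es) r)

  -- No nonempty closed walk starts at a vertex from which there is a walk to v.
  AcyclicTowards : Set
  AcyclicTowards = ∀ {x r s} → IsWalk x r x → r ≢ [] → ¬ IsWalk x s v

  module _ (acyclic : AcyclicTowards) where

    -- Split es into the edges into x and the rest.  A nonempty walk into x within es is
    -- a walk followed by an edge e into x, and the walk lies within the rest: otherwise
    -- it would have visited x before.  The induction is on the number of edges.
    walksWithin : ∀ es → Acc _<_ (length es) → ∀ {x s} → IsWalk x s v →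
      ∃[ rs ] (length rs ≤ SP (length es) × (∀ {r} → WalkIn es x r → r ∈ rs))
    walksWithin es (acc smaller) {x} {s} x⇝v =
      let rs , rs≤ , complete = gather (All.tabulate through) in
      [] ∷ rs
      , ≤-trans (s≤s rs≤) (subst (λ N → suc (length into * SP (length rest)) ≤ SP N) sizes
          (SP-bundle (length into) _))
      , λ {r} → split complete (initLast r)
      where
      into? : Decidable (λ e → target e ≡ x)
      into? e = target e ≟ x

      into rest : List (Fin (#E G))
      into = filter into? es
      rest = filter (¬? ∘ into?) es

      sizes : length into + length rest ≡ length es
      sizes = length-filter-¬ into? es

      rest-shorter : ∀ {e} → e ∈ into → length rest < length es
      rest-shorter e∈ = subst (length rest <_) sizes (+-monoˡ-≤ (length rest) (∈-length e∈))

      avoids : ∀ {y r e} → IsWalk y (r ∷ʳ e) x → All (_∈ es) r → All (_∈ rest) r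
      avoids {y} {r} {e} w inEs = All.tabulate λ {f} f∈r →
        ∈-filter⁺ (¬? ∘ into?) (All.lookup inEs f∈r) λ { refl →
          let r₁ , r₂ , r≡ = ∈-∃++ f∈r
              z , w′ , e-step = walk-split r w
              _ , _ , _ , _ , w₂ = walk-split r₁ (subst (λ r → IsWalk y r z) r≡ w′)
          in acyclic (walk-++ r₂ w₂ e-step)
               (λ eq → contradiction (++-conicalʳ r₂ (e ∷ []) eq) λ ()) x⇝v }

      -- The walks into x within es whose last edge is e.
      EndsWith : Fin (#E G) → List (Fin (#E G)) → Set
      EndsWith e r = ∃[ r′ ] (r ≡ r′ ∷ʳ e × WalkIn es x (r′ ∷ʳ e))

      through : ∀ {e} → e ∈ into →
        ∃[ rs ] (length rs ≤ SP (length rest) × (∀ {r} → EndsWith e r → r ∈ rs))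
      through {e} e∈ with source e ≟ v
      -- Edges leaving v do not occur in walks.
      ... | yes s≡v = [] , z≤n , λ { (r′ , _ , y , w , _) →
              let _ , _ , s≡z , z≢v , _ = walk-split r′ w
              in contradiction (trans (sym s≡z) s≡v) z≢v }
      ... | no s≢v
        with refl ← proj₂ (∈-filter⁻ into? {xs = es} e∈)
        with rs , rs≤ , complete ← walksWithin rest (smaller (rest-shorter e∈)) {s = e ∷ s} (refl , s≢v , x⇝v) =
        map (_∷ʳ e) rs , ≤-trans (≤-reflexive (length-map _ rs)) rs≤ , λ
          { (r′ , refl , y , w , inEs) → ∈-map⁺ (_∷ʳ e) (complete (y
            , (let _ , w₁ , s≡z , _ = walk-split r′ w in subst (IsWalk y r′) (sym s≡z) w₁)
            , avoids w (proj₁ (All.∷ʳ⁻ inEs)))) }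

      split : ∀ {rs} → (∀ {e r} → e ∈ into → EndsWith e r → r ∈ rs) →
              ∀ {r} → InitLast r → WalkIn es x r → r ∈ [] ∷ rs
      split complete []        _ = here refl
      split complete (r ∷ʳ′ e) (y , w , inEs) = there (complete
        (∈-filter⁺ into? (proj₂ (All.∷ʳ⁻ inEs))
          (let _ , _ , _ , _ , t≡x = walk-split r w in t≡x))
        (r , refl , y , w , inEs))

    allWalks : ∃[ rs ] (length rs ≤ SP (#E G) × (∀ {x r} → IsWalk x r v → r ∈ rs))
    allWalks with walksWithin (allFin (#E G)) (<-wellFounded _) {s = []} refl
    ... | rs , rs≤ , complete =
      rs , subst (λ N → length rs ≤ SP N) (length-tabulate {n = #E G} (λ e → e)) rs≤ ,
      λ {x} w → complete (x , w , All.tabulate (λ _ → ∈-allFin _))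

-- At the unique sink w all paths are walks, and acyclicity excludes closed ones.  A
-- path is determined by its edges, hence by their position in the list of walks.
pathCount≤SP : ∀ {N m} → IsPathCount N m → m ≤ SP N
pathCount≤SP {m = m} (G , refl , _ , acyclic , w , (w-sink , _) , count) =
  ≤-trans (injective⇒≤ {f = position} position-injective) rs≤
  where
  open Walks G w
  open Inverse count

  walk : ∀ {x} (p : Star (Step G) x w) → IsWalk x (edges p) w
  walk ε                      = refl
  walk ((e , refl , refl) ◅ p) = refl , w-sink e , walk p

  steps : ∀ {x y} e r → IsWalk x (e ∷ r) y → TransClosure (Step G) x y
  steps e []      (p , _ , q) = [ e , p , q ]
  steps e (f ∷ r) (p , _ , w) = (e , p , refl) ∷ steps f r w

  acyclicTowards : AcyclicTowards
  acyclicTowards {r = []}    _ r≢[] _ = r≢[] refl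
  acyclicTowards {r = e ∷ r} c _    _ = acyclic _ (steps e r c)

  rs : List (List (Fin (#E G)))
  rs = proj₁ (allWalks acyclicTowards)

  rs≤ : length rs ≤ SP (#E G)
  rs≤ = proj₁ (proj₂ (allWalks acyclicTowards))

  member : ∀ i → edges (proj₂ (to i)) ∈ rs
  member i = proj₂ (proj₂ (allWalks acyclicTowards)) (walk (proj₂ (to i)))

  position : Fin m → Fin (length rs)
  position i = index (member i)

  position-injective : ∀ {i j} → position i ≡ position j → i ≡ j
  position-injective {i} {j} eq = Injection.injective (↔⇒↣ count)
    (edges-injective _ _ (trans (lookup-index (member i))
      (trans (cong (lookup rs) eq) (sym (lookup-index (member j))))))

isSP : ∀ N → IsSP N (SP N)
isSP N = chainPathCount (SP-chain N) , λ _ → pathCount≤SP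

------------------------------------------------------------------------
-- The image of a Leavitt path algebra in a matrix algebra

module MatrixImage {c ℓ} (K : Field c ℓ) (n : ℕ) (G : FiniteDigraph)
                   (iso : leavittPathAlgebra K G ≅ matrixAlgebra K n) where
  open FiniteDigraph G hiding (#V; #E)
  open Matrices K n
  open _≅_ iso renaming (to to φ)
  open IsLeftModuleIsomorphism isLeftModuleIsomorphism
    using (surjective; ⟦⟧-cong; +ᴹ-homo; 0ᴹ-homo; -ᴹ-homo; *ₗ-homo)
  open SetoidReasoning ≈ᴹ-setoid

  private
    module K = Field K
    open RingProperties K.ring using (-1*x≈-x; -0#≈0#)

    Mat : Set c
    Mat = Matrix K n

  -- The images of the vertices, edges and ghost edges under the isomorphism.
  V : Fin (#V G) → Mat
  V x = φ (gen (vertex x))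

  A A* : Fin (#E G) → Mat
  A  e = φ (gen (edge e))
  A* e = φ (gen (ghost e))

  private
    product : ∀ {s t u} → LeavittRelation K G (s ⊙ t) u → (φ s ∙ φ t) ≈ᴹ φ u
    product r = ≈ᴹ-trans (≈ᴹ-sym (∙-homo _ _)) (⟦⟧-cong (relation r))

    product-0 : ∀ {s t} → LeavittRelation K G (s ⊙ t) 𝟘 → (φ s ∙ φ t) ≈ᴹ 0ᴹ
    product-0 r = ≈ᴹ-trans (product r) 0ᴹ-homo

  VV : ∀ x → (V x ∙ V x) ≈ᴹ V x
  VV x = product (vertex-idem x)

  VV-≢ : ∀ {x y} → x ≢ y → (V x ∙ V y) ≈ᴹ 0ᴹ
  VV-≢ x≢y = product-0 (vertex-orthogonal x≢y)

  VA : ∀ e → (V (source e) ∙ A e) ≈ᴹ A e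
  VA e = product (source-edge e)

  AV : ∀ e → (A e ∙ V (target e)) ≈ᴹ A e
  AV e = product (edge-target e)

  VA* : ∀ e → (V (target e) ∙ A* e) ≈ᴹ A* e
  VA* e = product (target-ghost e)

  A*V : ∀ e → (A* e ∙ V (source e)) ≈ᴹ A* e
  A*V e = product (ghost-source e)

  A*A : ∀ e → (A* e ∙ A e) ≈ᴹ V (target e)
  A*A e = product (ghost-edge e)

  A*A-≢ : ∀ {e f} → e ≢ f → (A* e ∙ A f) ≈ᴹ 0ᴹ
  A*A-≢ e≢f = product-0 (ghost-edge-≢ e≢f)

  -- Products in which two adjacent factors simplify.
  absorbˡ : ∀ {X Y Z} W → (X ∙ Y) ≈ᴹ Z → (X ∙ (Y ∙ W)) ≈ᴹ (Z ∙ W)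
  absorbˡ W p = ≈ᴹ-trans (≈ᴹ-sym (∙-assoc _ _ W)) (∙-congʳ p)

  absorbʳ : ∀ {X Y Z} W → (X ∙ Y) ≈ᴹ Z → ((W ∙ X) ∙ Y) ≈ᴹ (W ∙ Z)
  absorbʳ W p = ≈ᴹ-trans (∙-assoc W _ _) (∙-congˡ p)

  killˡ : ∀ {X Y} W → (X ∙ Y) ≈ᴹ 0ᴹ → (X ∙ (Y ∙ W)) ≈ᴹ 0ᴹ
  killˡ W p = ≈ᴹ-trans (absorbˡ W p) (∙-zeroˡ W)

  killʳ : ∀ {X Y} W → (X ∙ Y) ≈ᴹ 0ᴹ → ((W ∙ X) ∙ Y) ≈ᴹ 0ᴹ
  killʳ W p = ≈ᴹ-trans (absorbʳ W p) (∙-zeroʳ W)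

  -- The image of the path r into y, and of the reversed path of ghost edges.  For
  -- r = [] both are the image of the vertex y.
  path path* : List (Fin (#E G)) → Fin (#V G) → Mat
  path  r y = foldr (λ e X → A e ∙ X) (V y) r
  path* r y = foldr (λ e X → X ∙ A* e) (V y) r

  module _ {v : Fin (#V G)} where
    open Walks G v

    V-path : ∀ {x y} r → IsWalk x r y → (V x ∙ path r y) ≈ᴹ path r y
    V-path []      refl             = VV _
    V-path (e ∷ r) (refl , _ , _)   = absorbˡ _ (VA e)

    path-V : ∀ {y} r → (path r y ∙ V y) ≈ᴹ path r y
    path-V []      = VV _
    path-V (e ∷ r) = absorbʳ (A e) (path-V r)

    V-path* : ∀ {y} r → (V y ∙ path* r y) ≈ᴹ path* r y
    V-path* []      = VV _
    V-path* (e ∷ r) = absorbˡ (A* e) (V-path* r)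

    path*-V : ∀ {x y} r → IsWalk x r y → (path* r y ∙ V x) ≈ᴹ path* r y
    path*-V []      refl           = VV _
    path*-V (e ∷ r) (refl , _ , _) = absorbʳ _ (A*V e)

    cancel-edge : ∀ e {X Y} → (V (target e) ∙ X) ≈ᴹ X → ((Y ∙ A* e) ∙ (A e ∙ X)) ≈ᴹ (Y ∙ X)
    cancel-edge e {X} {Y} VX≈X = begin
      (Y ∙ A* e) ∙ (A e ∙ X)   ≈⟨ ∙-assoc Y (A* e) _ ⟩
      Y ∙ (A* e ∙ (A e ∙ X))   ≈⟨ ∙-congˡ (absorbˡ X (A*A e)) ⟩
      Y ∙ (V (target e) ∙ X)   ≈⟨ ∙-congˡ VX≈X ⟩
      Y ∙ X                    ∎

    path*-path : ∀ {x y} r → IsWalk x r y → (path* r y ∙ path r y) ≈ᴹ V y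
    path*-path []      _           = VV _
    path*-path (e ∷ r) (_ , _ , w) =
      ≈ᴹ-trans (cancel-edge e (V-path r w)) (path*-path r w)

    -- Either r is an initial segment of s, or the ghost path of s annihilates r.  The
    -- walk s cannot be a proper initial segment of r, since r may visit v only at its
    -- end.
    compare : ∀ r s {x y} → IsWalk x r y → IsWalk x s v →
      (∃[ s′ ] (s ≡ r ++ s′ × IsWalk y s′ v)) ⊎ (path* s v ∙ path r y) ≈ᴹ 0ᴹ
    compare []      s       refl          w      = inj₁ (s , refl , w)
    compare (e ∷ r) []      (_ , x≢v , _)   x≡v    = contradiction x≡v x≢v
    compare (e ∷ r) (f ∷ s) (_ , _ , w)     (_ , _ , w′) with f ≟ e
    ... | no f≢e = inj₂ (≈ᴹ-trans (∙-assoc _ (A* f) _)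
      (≈ᴹ-trans (∙-congˡ (killˡ _ (A*A-≢ f≢e))) (∙-zeroʳ _)))
    ... | yes refl with compare r s w w′
    ...   | inj₁ (s′ , s≡r++s′ , w″) = inj₁ (s′ , cong (e ∷_) s≡r++s′ , w″)
    ...   | inj₂ s*r≈0 = inj₂ (≈ᴹ-trans (cancel-edge e (V-path r w)) s*r≈0)

    -- If D is invertible in the corner of V x, then Z* D = 0 implies Z* = 0.
    exhausted : ∀ {x D D* Z Z*} → (D ∙ D*) ≈ᴹ V x → (Z* ∙ V x) ≈ᴹ Z* →
      (Z* ∙ Z) ≈ᴹ V v → (Z* ∙ D) ≈ᴹ 0ᴹ → V v ≈ᴹ 0ᴹ
    exhausted {x} {D} {D*} {Z} {Z*} DD*≈V Z*V≈Z* Z*Z≈V Z*D≈0 = begin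
      V v              ≈⟨ Z*Z≈V ⟨
      Z* ∙ Z           ≈⟨ ∙-congʳ Z*V≈Z* ⟨
      (Z* ∙ V x) ∙ Z   ≈⟨ ∙-congʳ (∙-congˡ DD*≈V) ⟨
      (Z* ∙ (D ∙ D*)) ∙ Z  ≈⟨ ∙-congʳ (killˡ D* Z*D≈0) ⟩
      0ᴹ ∙ Z           ≈⟨ ∙-zeroˡ Z ⟩
      0ᴹ               ∎

    closed-invertible : ∀ {x} r → IsWalk x r x → ¬ ¬ ((path r x ∙ path* r x) ≈ᴹ V x)
    closed-invertible {x} r w = dedekindFinite (VV x) (V-path r w) (path-V r)
      (V-path* r) (path*-V r w) (path*-path r w)

    -- The remaining arguments concern a vertex v with nonzero image.
    module Live (V≉0 : ¬ (V v ≈ᴹ 0ᴹ)) where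

      -- A closed walk at x is invertible in the corner of V x.  Hence the ghost path of a
      -- walk s from x to v does not annihilate it, so it is an initial segment of s.
      -- Remove it from s and repeat; this cannot go on forever.
      acyclicTowards : AcyclicTowards
      acyclicTowards {r = []}    _      r≢[] _ = r≢[] refl
      acyclicTowards {x} {r = e ∷ r} {s} closed _ = closed-avoids (length s) ≤-refl
        where
        closed-avoids : ∀ k {s} → length s ≤ k → ¬ IsWalk x s v
        closed-avoids k {s} s≤k w with compare (e ∷ r) s closed w
        closed-avoids (suc k) s≤k w | inj₁ (s′ , refl , w′) = closed-avoids k
          (≤-trans (≤-trans (m≤n+m _ (length r)) (≤-reflexive (sym (length-++ r)))) (s≤s⁻¹ s≤k)) w′
        closed-avoids k {s} s≤k w | inj₂ s*r≈0 = closed-invertible (e ∷ r) closed λ rr*≈V →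
          V≉0 (exhausted rr*≈V (path*-V s w) (path*-path s w) s*r≈0)

      -- The matrices that arise from one in D by multiplication with a walk to v.
      Multiple : ∀ {d} → (Mat → Set d) → Mat → Set (c ⊔ ℓ ⊔ d)
      Multiple D X = ∃[ x ] ∃[ r ] ∃[ M ] (IsWalk x r v × D M × X ≈ᴹ (path r v ∙ M))

      -- The span of B is a left ideal of the matrix algebra.
      LeftIdeal : ∀ {b} → (Mat → Set b) → Set _
      LeftIdeal B = ∀ Y {X} → Span B X → Span B (Y ∙ X)

      module _ {b} {B : Mat → Set b} (generators : ∀ g {X} → B X → Span B (φ (gen g) ∙ X)) where

        generator-span : ∀ g {X} → Span B X → Span B (φ (gen g) ∙ X)
        generator-span g (base b)            = generators g b
        generator-span g (resp X≈Y s)        = resp (∙-congˡ X≈Y) (generator-span g s)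
        generator-span g zero                = resp (≈ᴹ-sym (∙-zeroʳ _)) zero
        generator-span g (add {X} {Y} s t)   =
          resp (≈ᴹ-sym (∙-distribˡ _ X Y)) (add (generator-span g s) (generator-span g t))
        generator-span g (scale k {X} s)     =
          resp (≈ᴹ-sym (*ₗ-∙ʳ k _ X)) (scale k (generator-span g s))

        term-span : ∀ t {X} → Span B X → Span B (φ t ∙ X)
        term-span (gen g) s = generator-span g s
        term-span 𝟘 {X} s   = resp (≈ᴹ-sym (≈ᴹ-trans (∙-congʳ 0ᴹ-homo) (∙-zeroˡ X))) zero
        term-span (t ⊕ u) {X} s = resp
          (≈ᴹ-sym (≈ᴹ-trans (∙-congʳ (+ᴹ-homo t u)) (∙-distribʳ X (φ t) (φ u))))
          (add (term-span t s) (term-span u s))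
        term-span (⊖ t) {X} s = resp
          (≈ᴹ-sym (≈ᴹ-trans (∙-congʳ (≈ᴹ-trans (-ᴹ-homo t) (λ i j → K.sym (-1*x≈-x (φ t i j)))))
            (*ₗ-∙ˡ (K.- K.1#) (φ t) X)))
          (scale (K.- K.1#) (term-span t s))
        term-span (k · t) {X} s = resp
          (≈ᴹ-sym (≈ᴹ-trans (∙-congʳ (*ₗ-homo k t)) (*ₗ-∙ˡ k (φ t) X)))
          (scale k (term-span t s))
        term-span (t ⊙ u) {X} s = resp
          (≈ᴹ-sym (≈ᴹ-trans (∙-congʳ (∙-homo t u)) (∙-assoc (φ t) (φ u) X)))
          (term-span t (term-span u s))

        -- As the generators of the Leavitt path algebra generate the matrix algebra, it
        -- suffices that their images respect the span.
        leftIdeal : LeftIdeal B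
        leftIdeal Y s with t , φt≈ ← surjective Y = resp (∙-congʳ (φt≈ ≈-refl)) (term-span t s)

      -- The relations of the Leavitt path algebra take care of all products of a
      -- generator with a multiple, except those with edges and ghost edges at v itself.
      module _ {d} {D : Mat → Set d} (V-D : ∀ {X} → D X → (V v ∙ X) ≈ᴹ X)
        (edge-out  : ∀ e r {X} → source e ≡ v → IsWalk (target e) r v → D X →
                     Span (Multiple D) (A e ∙ (path r v ∙ X)))
        (ghost-out : ∀ e {X} → source e ≡ v → D X → Span (Multiple D) (A* e ∙ X)) where

        multiples-generators : ∀ g {X} → Multiple D X → Span (Multiple D) (φ (gen g) ∙ X)
        multiples-generators (vertex u) {X} (x , r , M , w , d , X≈) with u ≟ x
        ... | yes refl = base (x , r , M , w , d ,
                ≈ᴹ-trans (∙-congˡ X≈) (absorbˡ M (V-path r w)))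
        ... | no u≢x = resp (≈ᴹ-sym (begin
                V u ∙ X                        ≈⟨ ∙-congˡ X≈ ⟩
                V u ∙ (path r v ∙ M)           ≈⟨ ∙-congˡ (absorbˡ M (V-path r w)) ⟨
                V u ∙ (V x ∙ (path r v ∙ M))   ≈⟨ killˡ _ (VV-≢ u≢x) ⟩
                0ᴹ                             ∎)) zero
        multiples-generators (edge e) {X} (x , r , M , w , d , X≈) with target e ≟ x | source e ≟ v
        ... | no t≢x | _ = resp (≈ᴹ-sym (begin
                A e ∙ X                           ≈⟨ ∙-cong (AV e) (≈ᴹ-sym X≈) ⟨
                (A e ∙ V (target e)) ∙ (path r v ∙ M)  ≈⟨ ∙-congˡ (absorbˡ M (V-path r w)) ⟨
                (A e ∙ V (target e)) ∙ (V x ∙ (path r v ∙ M))  ≈⟨ killˡ _ (killʳ (A e) (VV-≢ t≢x)) ⟩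
                0ᴹ                                ∎)) zero
        ... | yes refl | yes s≡v = resp (∙-congˡ (≈ᴹ-sym X≈)) (edge-out e r s≡v w d)
        ... | yes refl | no s≢v  = base (source e , e ∷ r , M , (refl , s≢v , w) , d ,
                ≈ᴹ-trans (∙-congˡ X≈) (≈ᴹ-sym (∙-assoc (A e) _ M)))
        multiples-generators (ghost e) {X} (x , [] , M , refl , d , X≈) with source e ≟ v
        ... | yes s≡v = resp (∙-congˡ (≈ᴹ-sym (≈ᴹ-trans X≈ (V-D d)))) (ghost-out e s≡v d)
        ... | no s≢v = resp (≈ᴹ-sym (begin
                A* e ∙ X                              ≈⟨ ∙-cong (A*V e) (≈ᴹ-sym X≈) ⟨
                (A* e ∙ V (source e)) ∙ (V v ∙ M)     ≈⟨ killˡ M (killʳ (A* e) (VV-≢ s≢v)) ⟩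
                0ᴹ                                    ∎)) zero
        multiples-generators (ghost e) {X} (x , f ∷ r , M , (_ , _ , w) , d , X≈) with e ≟ f
        ... | yes refl = base (target e , r , M , w , d , (begin
                A* e ∙ X                              ≈⟨ ∙-congˡ X≈ ⟩
                A* e ∙ ((A e ∙ path r v) ∙ M)         ≈⟨ ∙-congˡ (∙-assoc (A e) _ M) ⟩
                A* e ∙ (A e ∙ (path r v ∙ M))         ≈⟨ absorbˡ _ (A*A e) ⟩
                V (target e) ∙ (path r v ∙ M)         ≈⟨ absorbˡ M (V-path r w) ⟩
                path r v ∙ M                          ∎))
        ... | no e≢f = resp (≈ᴹ-sym (begin
                A* e ∙ X                              ≈⟨ ∙-congˡ X≈ ⟩
                A* e ∙ ((A f ∙ path r v) ∙ M)         ≈⟨ ∙-congˡ (∙-assoc (A f) _ M) ⟩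
                A* e ∙ (A f ∙ (path r v ∙ M))         ≈⟨ killˡ _ (A*A-≢ e≢f) ⟩
                0ᴹ                                    ∎)) zero

        multiples-leftIdeal : LeftIdeal (Multiple D)
        multiples-leftIdeal = leftIdeal multiples-generators

      -- The scalar multiples of V v.
      ScalarV : Mat → Set (c ⊔ ℓ)
      ScalarV X = ∃[ k ] X ≈ᴹ (k *ₗ V v)

      V-ScalarV : ∀ {X} → ScalarV X → (V v ∙ X) ≈ᴹ X
      V-ScalarV {X} (k , X≈kV) = begin
        V v ∙ X            ≈⟨ ∙-congˡ X≈kV ⟩
        V v ∙ (k *ₗ V v)   ≈⟨ *ₗ-∙ʳ k (V v) (V v) ⟩
        k *ₗ (V v ∙ V v)   ≈⟨ *ₗ-cong K.refl (VV v) ⟩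
        k *ₗ V v           ≈⟨ X≈kV ⟨
        X                  ∎

      V∈span : ∀ {d} {D : Mat → Set d} → D (V v) → Span (Multiple D) (V v)
      V∈span d = base (v , [] , V v , refl , d , ≈ᴹ-sym (VV v))

      -- If the walks to v, multiplied by V v, span a left ideal, then they also span the
      -- space of columns.
      scalar-leftIdeal⇒bound : LeftIdeal (Multiple ScalarV) → ¬ (SP (#E G) < n)
      scalar-leftIdeal⇒bound ideal SP<n
        with rs , rs≤ , complete ← allWalks acyclicTowards =
        spanning-≤ (λ i → path (lookup rs i) v)
          (λ { {X} (x , r , M , w , (k , M≈kV) , X≈) →
            index (complete w) , k , (begin
              X                          ≈⟨ X≈ ⟩
              path r v ∙ M               ≈⟨ ∙-congˡ M≈kV ⟩
              path r v ∙ (k *ₗ V v)      ≈⟨ *ₗ-∙ʳ k (path r v) (V v) ⟩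
              k *ₗ (path r v ∙ V v)      ≈⟨ *ₗ-cong K.refl (path-V r) ⟩
              k *ₗ path r v              ≡⟨ cong (λ r → k *ₗ path r v) (lookup-index (complete w)) ⟩
              k *ₗ path (lookup rs (index (complete w))) v  ∎) })
          V≉0 (λ Y → ideal Y (V∈span (K.1# , λ i j → K.sym (K.*-identityˡ (V v i j)))))
          (≤-<-trans rs≤ SP<n)

      sink-bound : IsSink G v → ¬ (SP (#E G) < n)
      sink-bound sink = scalar-leftIdeal⇒bound (multiples-leftIdeal V-ScalarV
        (λ e _ s≡v → contradiction s≡v (sink e)) (λ e s≡v → contradiction s≡v (sink e)))

      -- An edge e₀ leaving v followed by a walk r₀ back to v.  As r₀ visits v only at its
      -- end, this is a closed path that returns to v just once.
      module Cycle {e₀ r₀} (s≡v : source e₀ ≡ v) (w₀ : IsWalk (target e₀) r₀ v) where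

        C C* : Mat
        C  = A e₀ ∙ path r₀ v
        C* = path* r₀ v ∙ A* e₀

        VC : (V v ∙ C) ≈ᴹ C
        VC = absorbˡ _ (subst (λ x → (V x ∙ A e₀) ≈ᴹ A e₀) s≡v (VA e₀))

        CV : (C ∙ V v) ≈ᴹ C
        CV = absorbʳ (A e₀) (path-V r₀)

        VC* : (V v ∙ C*) ≈ᴹ C*
        VC* = absorbˡ (A* e₀) (V-path* r₀)

        A*V′ : ∀ {e} → source e ≡ v → (A* e ∙ V v) ≈ᴹ A* e
        A*V′ {e} s≡v = subst (λ x → (A* e ∙ V x) ≈ᴹ A* e) s≡v (A*V e)

        C*V : (C* ∙ V v) ≈ᴹ C*
        C*V = absorbʳ _ (A*V′ s≡v)

        C*C : (C* ∙ C) ≈ᴹ V v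
        C*C = ≈ᴹ-trans (cancel-edge e₀ (V-path r₀ w₀)) (path*-path r₀ w₀)

        -- By Dedekind finiteness the following hypothesis holds up to double negation.
        module _ (CC* : (C ∙ C*) ≈ᴹ V v) where

          incomparable : ∀ {e r} → source e ≡ v → IsWalk (target e) r v →
                         ¬ ((path* r v ∙ A* e) ∙ C) ≈ᴹ 0ᴹ
          incomparable {e} {r} s≡v w r*C≈0 = V≉0 (exhausted CC* (absorbʳ _ (A*V′ s≡v))
            (≈ᴹ-trans (cancel-edge e (V-path r w)) (path*-path r w)) r*C≈0)

          -- Only one closed path at v returns to v just once.
          unique : ∀ e r → source e ≡ v → IsWalk (target e) r v → (A e ∙ path r v) ≈ᴹ C
          unique e r s≡v w with e ≟ e₀
          ... | no e≢e₀ = contradiction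
            (≈ᴹ-trans (∙-assoc _ (A* e) _) (≈ᴹ-trans (∙-congˡ (killˡ _ (A*A-≢ e≢e₀))) (∙-zeroʳ _)))
            (incomparable s≡v w)
          ... | yes refl with compare r₀ r w₀ w
          ...   | inj₁ ([] , refl , _) rewrite ++-identityʳ r₀ = ≈ᴹ-refl
          ...   | inj₁ (_ ∷ _ , _ , (_ , v≢v , _)) = contradiction refl v≢v
          ...   | inj₂ r*r₀≈0 = contradiction
            (≈ᴹ-trans (cancel-edge e (V-path r₀ w₀)) r*r₀≈0) (incomparable s≡v w)

          -- An edge leaving v, followed by a walk back to v, is C, which preserves D; and a
          -- ghost edge at v vanishes on D or is the walk r₀ times C*.
          cycle-leftIdeal : ∀ {d} {D : Mat → Set d} → (∀ {X} → D X → (V v ∙ X) ≈ᴹ X) →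
            (∀ {X} → D X → D (C ∙ X)) → (∀ {X} → D X → D (C* ∙ X)) → LeftIdeal (Multiple D)
          cycle-leftIdeal {D = D} V-D C-D C*-D = multiples-leftIdeal V-D
            (λ e r {X} s≡v w d → base (v , [] , C ∙ X , refl , C-D d , (begin
              A e ∙ (path r v ∙ X)    ≈⟨ absorbˡ X (unique e r s≡v w) ⟩
              C ∙ X                   ≈⟨ V-D (C-D d) ⟨
              V v ∙ (C ∙ X)           ∎)))
            ghost-out
            where
            -- As C C* = V v, every X in D is C times the element C* X of D.
            ghost-C : ∀ e {X} → D X → (A* e ∙ X) ≈ᴹ (A* e ∙ (A e₀ ∙ (path r₀ v ∙ (C* ∙ X))))
            ghost-C e {X} d = ∙-congˡ (begin
              X                                   ≈⟨ V-D d ⟨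
              V v ∙ X                             ≈⟨ absorbˡ X CC* ⟨
              C ∙ (C* ∙ X)                        ≈⟨ ∙-assoc (A e₀) (path r₀ v) (C* ∙ X) ⟩
              A e₀ ∙ (path r₀ v ∙ (C* ∙ X))       ∎)

            ghost-out : ∀ e {X} → source e ≡ v → D X → Span (Multiple D) (A* e ∙ X)
            ghost-out e {X} _ d with e ≟ e₀
            ... | no e≢e₀ = resp (≈ᴹ-sym (≈ᴹ-trans (ghost-C e d) (killˡ _ (A*A-≢ e≢e₀)))) zero
            ... | yes refl = base (target e , r₀ , C* ∙ X , w₀ , C*-D d , (begin
              A* e ∙ X                                      ≈⟨ ghost-C e d ⟩
              A* e ∙ (A e ∙ (path r₀ v ∙ (C* ∙ X)))         ≈⟨ absorbˡ _ (A*A e) ⟩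
              V (target e) ∙ (path r₀ v ∙ (C* ∙ X))         ≈⟨ absorbˡ _ (V-path r₀ w₀) ⟩
              path r₀ v ∙ (C* ∙ X)                          ∎))

          Commuting : Mat → Set ℓ
          Commuting X = (V v ∙ X) ≈ᴹ X × (C ∙ X) ≈ᴹ (X ∙ C)

          commuting-leftIdeal : LeftIdeal (Multiple Commuting)
          commuting-leftIdeal = cycle-leftIdeal proj₁
            (λ {X} (_ , CX≈XC) → absorbˡ X VC ,
              ≈ᴹ-trans (∙-congˡ CX≈XC) (≈ᴹ-sym (∙-assoc C X C)))
            (λ {X} (VX≈X , CX≈XC) → absorbˡ X VC* , (begin
              C ∙ (C* ∙ X)      ≈⟨ absorbˡ X CC* ⟩
              V v ∙ X           ≈⟨ absorbˡ X C*C ⟨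
              C* ∙ (C ∙ X)      ≈⟨ ∙-congˡ CX≈XC ⟩
              C* ∙ (X ∙ C)      ≈⟨ ∙-assoc C* X C ⟨
              (C* ∙ X) ∙ C      ∎))

          -- The corner V v ∙ X of an element of the left ideal commutes with C.
          corner-commutes : ∀ {X} → Span (Multiple Commuting) X → (C ∙ (V v ∙ X)) ≈ᴹ ((V v ∙ X) ∙ C)
          corner-commutes (base {X} (_ , [] , M , refl , (VM≈M , CM≈MC) , X≈)) = begin
            C ∙ (V v ∙ X)     ≈⟨ ∙-congˡ VX≈M ⟩
            C ∙ M             ≈⟨ CM≈MC ⟩
            M ∙ C             ≈⟨ ∙-congʳ VX≈M ⟨
            (V v ∙ X) ∙ C     ∎
            where
            VX≈M : (V v ∙ X) ≈ᴹ M
            VX≈M = ≈ᴹ-trans (∙-congˡ (≈ᴹ-trans X≈ VM≈M)) VM≈M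
          corner-commutes (base {X} (_ , e ∷ r , M , (refl , s≢v , _) , _ , X≈)) = begin
            C ∙ (V v ∙ X)     ≈⟨ ∙-congˡ VX≈0 ⟩
            C ∙ 0ᴹ            ≈⟨ ∙-zeroʳ C ⟩
            0ᴹ                ≈⟨ ∙-zeroˡ C ⟨
            0ᴹ ∙ C            ≈⟨ ∙-congʳ VX≈0 ⟨
            (V v ∙ X) ∙ C     ∎
            where
            VX≈0 : (V v ∙ X) ≈ᴹ 0ᴹ
            VX≈0 = begin
              V v ∙ X                                       ≈⟨ ∙-congˡ X≈ ⟩
              V v ∙ ((A e ∙ path r v) ∙ M)                  ≈⟨ ∙-congˡ (∙-congʳ (absorbˡ _ (VA e))) ⟨
              V v ∙ ((V (source e) ∙ (A e ∙ path r v)) ∙ M) ≈⟨ ∙-congˡ (∙-assoc _ _ M) ⟩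
              V v ∙ (V (source e) ∙ ((A e ∙ path r v) ∙ M)) ≈⟨ killˡ _ (VV-≢ (s≢v ∘ sym)) ⟩
              0ᴹ                                            ∎
          corner-commutes (resp {X} {Y} X≈Y s) = begin
            C ∙ (V v ∙ Y)     ≈⟨ ∙-congˡ (∙-congˡ X≈Y) ⟨
            C ∙ (V v ∙ X)     ≈⟨ corner-commutes s ⟩
            (V v ∙ X) ∙ C     ≈⟨ ∙-congʳ (∙-congˡ X≈Y) ⟩
            (V v ∙ Y) ∙ C     ∎
          corner-commutes zero = begin
            C ∙ (V v ∙ 0ᴹ)    ≈⟨ ∙-congˡ (∙-zeroʳ (V v)) ⟩
            C ∙ 0ᴹ            ≈⟨ ∙-zeroʳ C ⟩
            0ᴹ                ≈⟨ ∙-zeroˡ C ⟨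
            0ᴹ ∙ C            ≈⟨ ∙-congʳ (∙-zeroʳ (V v)) ⟨
            (V v ∙ 0ᴹ) ∙ C    ∎
          corner-commutes (add {X} {Y} s t) = begin
            C ∙ (V v ∙ (X +ᴹ Y))                  ≈⟨ ∙-congˡ (∙-distribˡ (V v) X Y) ⟩
            C ∙ ((V v ∙ X) +ᴹ (V v ∙ Y))          ≈⟨ ∙-distribˡ C _ _ ⟩
            (C ∙ (V v ∙ X)) +ᴹ (C ∙ (V v ∙ Y))    ≈⟨ +ᴹ-cong (corner-commutes s) (corner-commutes t) ⟩
            ((V v ∙ X) ∙ C) +ᴹ ((V v ∙ Y) ∙ C)    ≈⟨ ∙-distribʳ C _ _ ⟨
            ((V v ∙ X) +ᴹ (V v ∙ Y)) ∙ C          ≈⟨ ∙-congʳ (∙-distribˡ (V v) X Y) ⟨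
            (V v ∙ (X +ᴹ Y)) ∙ C                  ∎
          corner-commutes (scale k {X} s) = begin
            C ∙ (V v ∙ (k *ₗ X))    ≈⟨ ∙-congˡ (*ₗ-∙ʳ k (V v) X) ⟩
            C ∙ (k *ₗ (V v ∙ X))    ≈⟨ *ₗ-∙ʳ k C _ ⟩
            k *ₗ (C ∙ (V v ∙ X))    ≈⟨ *ₗ-cong K.refl (corner-commutes s) ⟩
            k *ₗ ((V v ∙ X) ∙ C)    ≈⟨ *ₗ-∙ˡ k _ C ⟨
            (k *ₗ (V v ∙ X)) ∙ C    ≈⟨ ∙-congʳ (*ₗ-∙ʳ k (V v) X) ⟨
            (V v ∙ (k *ₗ X)) ∙ C    ∎

          C-scalar : ¬ ¬ ScalarV C
          C-scalar = central⇒scalar CV VC V≉0 λ Y → corner-commutes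
            (commuting-leftIdeal Y (V∈span (VV v , ≈ᴹ-trans CV (≈ᴹ-sym VC))))

          C*-scalar : ScalarV C → ScalarV C*
          C*-scalar (k , C≈kV) = let k⁻¹ , kk⁻¹≈1 = K.inverse k k≉0 in k⁻¹ , (begin
            C*                   ≈⟨ (λ i j → K.sym (K.*-identityˡ (C* i j))) ⟩
            K.1# *ₗ C*           ≈⟨ *ₗ-cong (K.trans (K.sym kk⁻¹≈1) (K.*-comm k k⁻¹)) (≈ᴹ-refl {C*}) ⟩
            (k⁻¹ K.* k) *ₗ C*    ≈⟨ *ₗ-assoc k⁻¹ k C* ⟩
            k⁻¹ *ₗ (k *ₗ C*)     ≈⟨ *ₗ-cong K.refl kC*≈V ⟩
            k⁻¹ *ₗ V v           ∎)
            where
            kC*≈V : (k *ₗ C*) ≈ᴹ V v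
            kC*≈V = begin
              k *ₗ C*             ≈⟨ *ₗ-cong K.refl VC* ⟨
              k *ₗ (V v ∙ C*)     ≈⟨ *ₗ-∙ˡ k (V v) C* ⟨
              (k *ₗ V v) ∙ C*     ≈⟨ ∙-congʳ C≈kV ⟨
              C ∙ C*              ≈⟨ CC* ⟩
              V v                 ∎

            k≉0 : ¬ (k K.≈ K.0#)
            k≉0 k≈0 = V≉0 (begin
              V v            ≈⟨ kC*≈V ⟨
              k *ₗ C*        ≈⟨ *ₗ-cong k≈0 (≈ᴹ-refl {C*}) ⟩
              K.0# *ₗ C*     ≈⟨ *ₗ-zeroˡ C* ⟩
              0ᴹ             ∎)

          scalar-∙ : ∀ {X Y} → (X ∙ V v) ≈ᴹ X → ScalarV X → ScalarV Y → ScalarV (X ∙ Y)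
          scalar-∙ {X} {Y} XV≈X (k , X≈kV) (l , Y≈lV) = l K.* k , (begin
            X ∙ Y               ≈⟨ ∙-congˡ Y≈lV ⟩
            X ∙ (l *ₗ V v)      ≈⟨ *ₗ-∙ʳ l X (V v) ⟩
            l *ₗ (X ∙ V v)      ≈⟨ *ₗ-cong K.refl (≈ᴹ-trans XV≈X X≈kV) ⟩
            l *ₗ (k *ₗ V v)     ≈⟨ *ₗ-assoc l k (V v) ⟨
            (l K.* k) *ₗ V v    ∎)

        cycle-bound : ¬ (SP (#E G) < n)
        cycle-bound SP<n = dedekindFinite (VV v) VC CV VC* C*V C*C λ CC* →
          C-scalar CC* λ scalar → scalar-leftIdeal⇒bound
            (cycle-leftIdeal CC* V-ScalarV (scalar-∙ CC* CV scalar)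
              (scalar-∙ CC* C*V (C*-scalar CC* scalar)))
            SP<n

  module _ {x} (targets-dead : ∀ e → source e ≡ x → V (target e) ≈ᴹ 0ᴹ) where

    sum-dead : ∀ {es} → All (λ e → source e ≡ x) es →
      φ (foldr _⊕_ 𝟘 (map (λ e → gen (edge e) ⊙ gen (ghost e)) es)) ≈ᴹ 0ᴹ
    sum-dead [] = 0ᴹ-homo
    sum-dead {e ∷ es} (s≡x ∷ ps) = begin
      φ ((gen (edge e) ⊙ gen (ghost e)) ⊕ _)
        ≈⟨ +ᴹ-homo _ _ ⟩
      φ (gen (edge e) ⊙ gen (ghost e)) +ᴹ φ (foldr _⊕_ 𝟘 (map (λ e → gen (edge e) ⊙ gen (ghost e)) es))
        ≈⟨ +ᴹ-cong (≈ᴹ-trans (∙-homo _ _) (≈ᴹ-trans (∙-congʳ A≈0) (∙-zeroˡ (A* e)))) (sum-dead ps) ⟩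
      0ᴹ +ᴹ 0ᴹ
        ≈⟨ +ᴹ-identityˡ 0ᴹ ⟩
      0ᴹ ∎
      where
      A≈0 : A e ≈ᴹ 0ᴹ
      A≈0 = ≈ᴹ-trans (≈ᴹ-sym (AV e)) (≈ᴹ-trans (∙-congˡ (targets-dead e s≡x)) (∙-zeroʳ (A e)))

    -- By the relation expressing V x as a sum over the edges that leave x.
    targets-dead⇒dead : ¬ IsSink G x → V x ≈ᴹ 0ᴹ
    targets-dead⇒dead ¬sink = ≈ᴹ-trans (⟦⟧-cong (relation (vertex-sum x ¬sink)))
      (sum-dead (All.all-filter (λ e → source e ≟ x) (allFin (#E G))))

  image-0 : (∀ x → V x ≈ᴹ 0ᴹ) → ∀ t → φ t ≈ᴹ 0ᴹ
  image-0 dead (gen (vertex x)) = dead x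
  image-0 dead (gen (edge e))   = ≈ᴹ-trans (≈ᴹ-sym (VA e)) (≈ᴹ-trans (∙-congʳ (dead _)) (∙-zeroˡ (A e)))
  image-0 dead (gen (ghost e))  = ≈ᴹ-trans (≈ᴹ-sym (VA* e)) (≈ᴹ-trans (∙-congʳ (dead _)) (∙-zeroˡ (A* e)))
  image-0 dead 𝟘                = 0ᴹ-homo
  image-0 dead (t ⊕ u)          = ≈ᴹ-trans (+ᴹ-homo t u)
      (≈ᴹ-trans (+ᴹ-cong (image-0 dead t) (image-0 dead u)) (+ᴹ-identityˡ 0ᴹ))
  image-0 dead (⊖ t)            = ≈ᴹ-trans (-ᴹ-homo t) (≈ᴹ-trans (-ᴹ‿cong (image-0 dead t)) (λ _ _ → -0#≈0#))
  image-0 dead (k · t)          = ≈ᴹ-trans (*ₗ-homo k t) (≈ᴹ-trans (*ₗ-cong K.refl (image-0 dead t)) (*ₗ-zeroʳ k))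
  image-0 dead (t ⊙ u)          = ≈ᴹ-trans (∙-homo t u)
      (≈ᴹ-trans (∙-congʳ (image-0 dead t)) (∙-zeroˡ (φ u)))

  ¬all-dead : 1 ≤ n → ¬ (∀ x → V x ≈ᴹ 0ᴹ)
  ¬all-dead 1≤n dead with t , φt≈ ← surjective (λ _ _ → K.1#) =
    K.1≉0 (≈ᴹ-trans (≈ᴹ-sym (φt≈ ≈-refl)) (image-0 dead t) (fromℕ< 1≤n) (fromℕ< 1≤n))

  -- Suppose that the bound fails.  Then no vertex with nonzero image is a sink.  Leave
  -- each of them by an edge whose target has nonzero image; the trail obtained in
  -- this way meets some vertex twice.
  module _ (1≤n : 1 ≤ n) (SP<n : SP (#E G) < n) (dead? : ∀ x → Dec (V x ≈ᴹ 0ᴹ)) where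

    LiveVertex : Set ℓ
    LiveVertex = ∃[ x ] ¬ (V x ≈ᴹ 0ᴹ)

    exit : ((x , _) : LiveVertex) → ∃[ e ] (source e ≡ x × ¬ (V (target e) ≈ᴹ 0ᴹ))
    exit (x , live) with any? (λ e → (source e ≟ x) ×-dec ¬? (dead? (target e)))
    ... | yes e = e
    ... | no ¬any = contradiction (targets-dead⇒dead targets-dead λ sink → Live.sink-bound live sink SP<n) live
      where
      targets-dead : ∀ e → source e ≡ x → V (target e) ≈ᴹ 0ᴹ
      targets-dead e s≡x with dead? (target e)
      ... | yes dead = dead
      ... | no ¬dead = contradiction (e , s≡x , ¬dead) ¬any

    trail : ℕ → LiveVertex
    trail zero    = ¬∀⟶∃¬ _ _ dead? (¬all-dead 1≤n)
    trail (suc k) = let e , _ , live = exit (trail k) in target e , live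

    at : ℕ → Fin (#V G)
    at k = proj₁ (trail k)

    -- A trail arriving at v contains a walk to v: stop at the first visit of v.
    return : ∀ v k m → at (k + m) ≡ v → ∃[ r ] Walks.IsWalk G v (at m) r v
    return v k m arrives with at m ≟ v
    return v k       m arrives | yes m≡v = [] , m≡v
    return v zero    m arrives | no m≢v  = contradiction arrives m≢v
    return v (suc k) m arrives | no m≢v
      with r , w ← return v k (suc m) (trans (cong at (+-suc k m)) arrives)
      with exit (trail m)
    ... | e , s≡m , _ = e ∷ r , s≡m , m≢v , w

    no-trail : ⊥
    no-trail with i , j , i<j , i≡j ← pigeonhole (n<1+n (#V G)) (λ k → at (toℕ k))
      with r , w ← return (at (toℕ i)) (toℕ j ∸ suc (toℕ i)) (suc (toℕ i))
             (trans (cong at (m∸n+n≡m i<j)) (sym i≡j)) =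
      Live.Cycle.cycle-bound (proj₂ (trail (toℕ i))) (proj₁ (proj₂ (exit (trail (toℕ i))))) w SP<n

  n≤SP : 1 ≤ n → n ≤ SP (#E G)
  n≤SP 1≤n = ≮⇒≥ λ SP<n →
    ¬¬-∀ (λ x → ¬¬-excluded-middle {A = V x ≈ᴹ 0ᴹ}) (no-trail 1≤n SP<n)

-- A decidable property of natural numbers that holds for 0 and is bounded above has
-- a maximum.
decidable-maximum : ∀ {P : ℕ → Set} → (∀ k → Dec (P k)) → P 0 →
  ∀ {b} → (∀ k → P k → k ≤ b) → ∃[ m ] IsMaximum P m
decidable-maximum {P} P? P0 {zero}  P≤b = 0 , P0 , P≤b
decidable-maximum {P} P? P0 {suc b} P≤b with P? (suc b)
... | yes Pb = suc b , Pb , P≤b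
... | no ¬Pb = decidable-maximum P? P0 {b} λ k Pk →
  s≤s⁻¹ (≤∧≢⇒< (P≤b k Pk) λ { refl → ¬Pb Pk })

corollary4p13 : ∀ {c ℓ} (K : Field c ℓ) (n : ℕ) → 1 ≤ n →
    (E : FiniteDigraph) → leavittPathAlgebra K E ≅ matrixAlgebra K n →
    ∃[ Nₙ ] (IsMaxEdges n Nₙ × Nₙ ≤ #E E)
corollary4p13 K n 1≤n E iso =
  let Nₙ , SPNₙ≤n , max = decidable-maximum (λ N → SP N ≤? n) (subst (_≤ n) (sym SP-0) 1≤n)
                           (λ N SPN≤n → ≤-trans (<⇒≤ (N<SP N)) SPN≤n)
  in Nₙ
   , ( (SP Nₙ , isSP Nₙ , SPNₙ≤n)
     , λ { M (s , (_ , s-max) , s≤n) → max M (≤-trans (s-max (SP M) (proj₁ (isSP M))) s≤n) })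
   , ≮⇒≥ λ #E<Nₙ → <⇒≱ (SP-mono-< #E<Nₙ) (≤-trans SPNₙ≤n (MatrixImage.n≤SP K n E iso 1≤n))
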